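{- Let $p_{9,3}(n)$ be defined by $\sum_{n\ge0}p_{9,3}(n)q^n=\frac{1}{E_1^3E_9^3}$. Let $m(i,j)$ and $c(j,k)$ be the integer matrices defined below. Then for every positive integer $j$, \begin{align*} \sum_{n=0}^{\infty}p_{9,3}\left(3^{2j-1}n+\tfrac{3^{2j-1}+5}{4}\right)q^{n} &=\sum_{l=1}^{\infty}c(2j-1,l)q^{l-1}\frac{E_{3}^{12l-6}}{E_{1}^{12l}},\\ \sum_{n=0}^{\infty}p_{9,3}\left(3^{2j}n+\tfrac{3^{2j+1}+5}{4}\right)q^{n} &=\sum_{l=1}^{\infty}c(2j,l)q^{l-1}\frac{E_{3}^{12l}}{E_{1}^{12l+6}}. \end{align*}
   Context: $E_j=(q^j;q^j)_\infty=\prod_{n\ge1}(1-q^{jn})$. The matrix $\{m(i,j)\}_{i,j\ge1}$ is defined by (with $m(i,j)=0$ for $i\le0$): $m(1,1)=9$, $m(2,1)=6$, $m(3,1)=1$, $m(i,1)=0$ for $i\ge4$, and for $j\ge2$, $m(i,j)=27m(i-1,j-1)+9m(i-2,j-1)+m(i-3,j-1)$. The matrix $\{c(j,k)\}_{j,k\ge1}$ is defined by $c(1,1)=9$, $c(1,k)=0$ for $k\ge2$, and for $j,k\ge1$: $c(j+1,k)=\sum_{i\ge1}c(j,i)m(4i,i+k)$ if $j$ is odd, and $c(j+1,k)=\sum_{i\ge1}c(j,i)m(4i+2,i+k)$ if $j$ is even (finite sums). -}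

module Defs where

open import Data.Nat as ℕ using (ℕ; zero; suc; _∸_; _^_; _/_)
open import Data.Nat.Base using (_%_)
open import Data.Integer as ℤ using (ℤ; +_; -_)
open import Data.List using (List; []; _∷_)
open import Data.Bool using (Bool; true; false; if_then_else_)

sumℤ : ℕ → (ℕ → ℤ) → ℤ
sumℤ zero    f = f 0
sumℤ (suc n) f = sumℤ n f ℤ.+ f (suc n)

sumℕ : ℕ → (ℕ → ℕ) → ℕ
sumℕ zero    f = f 0
sumℕ (suc n) f = sumℕ n f ℕ.+ f (suc n)

-- Formal power series over ℤ, represented by their coefficient sequence:
-- a series f stands for Σ_{n ≥ 0} f n · qⁿ.

Series : Set
Series = ℕ → ℤ

one : Series
one zero    = + 1
one (suc _) = + 0

infixl 7 _⊛_
_⊛_ : Series → Series → Series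
(f ⊛ g) n = sumℤ n (λ k → f k ℤ.* g (n ∸ k))

pow : Series → ℕ → Series
pow f zero    = one
pow f (suc k) = f ⊛ pow f k

oneMinusQ^ : ℕ → Series
oneMinusQ^ m n = one n ℤ.- (if n ℕ.≡ᵇ m then + 1 else + 0)

partialE : ℕ → ℕ → Series
partialE j zero    = one
partialE j (suc N) = partialE j N ⊛ oneMinusQ^ (j ℕ.* suc N)

-- E_j = (q^j;q^j)_∞ = Π_{k ≥ 1} (1 - q^{j k}).  For j ≥ 1 the coefficient
-- of qⁿ of the infinite product equals that of the partial product over
-- k = 1..n (later factors only affect degrees > n).
E : ℕ → Series
E j n = partialE j n n

-- Reciprocal 1/f of a series with constant term 1 (all series inverted
-- below are products of E_j's, whose constant term is 1):
-- g 0 = 1,  g (n+1) = - Σ_{k=1}^{n+1} f k · g (n+1-k).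
-- invUpTo f n = [g n , g (n-1) , … , g 0].
private
  dot : (ℕ → ℤ) → ℕ → List ℤ → ℤ
  dot f k []       = + 0
  dot f k (x ∷ xs) = f k ℤ.* x ℤ.+ dot f (suc k) xs

  invUpTo : Series → ℕ → List ℤ
  invUpTo f zero    = + 1 ∷ []
  invUpTo f (suc n) = (- dot f 1 (invUpTo f n)) ∷ invUpTo f n

  headOr0 : List ℤ → ℤ
  headOr0 []      = + 0
  headOr0 (x ∷ _) = x

inv : Series → Series
inv f n = headOr0 (invUpTo f n)

p93 : ℕ → ℤ
p93 = inv (pow (E 1) 3 ⊛ pow (E 9) 3)

-- The matrix m(i,j)  (i, j ≥ 1; m(i,j) = 0 for i ≤ 0; index 0 in the
-- second argument is outside the domain and set to 0).

m : ℕ → ℕ → ℕ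
m zero    _             = 0
m (suc i) zero          = 0
m (suc i) (suc zero)    with i
... | 0 = 9
... | 1 = 6
... | 2 = 1
... | _ = 0
m (suc i) (suc (suc j)) =
  27 ℕ.* m i (suc j) ℕ.+ 9 ℕ.* m (i ∸ 1) (suc j) ℕ.+ m (i ∸ 2) (suc j)

isOdd : ℕ → Bool
isOdd n = (n % 2) ℕ.≡ᵇ 1

-- The matrix c(j,k)  (j, k ≥ 1; index 0 outside the domain, set to 0).
-- The sum over i ≥ 1 is finite: m(i', j') = 0 unless i' ≤ 3 j', so
-- m(4i, i+k) and m(4i+2, i+k) vanish for i > 3k; we sum over i = 1..3k.
c : ℕ → ℕ → ℕ
c zero          _       = 0
c (suc j)       zero    = 0
c (suc zero)    (suc zero)    = 9
c (suc zero)    (suc (suc k)) = 0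
c (suc (suc j)) (suc k) =
  sumℕ (3 ℕ.* suc k) λ i →
    c (suc j) i ℕ.* m (if isOdd (suc j) then 4 ℕ.* i else 4 ℕ.* i ℕ.+ 2) (i ℕ.+ suc k)

-- Σ_{l ≥ 1} a(l) q^{l-1} F_l  as a formal power series:
-- coefficient of qⁿ is Σ_{l=1}^{n+1} a(l) · [q^{n-(l-1)}] F_l.

shiftedSum : (ℕ → ℕ) → (ℕ → Series) → Series
shiftedSum a F n = sumℤ n (λ l' → + a (suc l') ℤ.* F (suc l') (n ∸ l'))

F-odd : ℕ → Series
F-odd l = pow (E 3) (12 ℕ.* l ∸ 6) ⊛ inv (pow (E 1) (12 ℕ.* l))

F-even : ℕ → Series
F-even l = pow (E 3) (12 ℕ.* l) ⊛ inv (pow (E 1) (12 ℕ.* l ℕ.+ 6))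

{-# OPTIONS --safe #-}

-- Write V for q ↦ q³ and U for the extraction of the coefficients of q³ⁿ.  With ω a primitive cube root
-- of unity, Jacobi's formula E₁³ = Σ (-1)ᵏ (2k+1) q^(k(k+1)/2) gives E₁³ = V P - 3 q E₉³, and multiplying
-- the conjugates E₁(q) E₁(ωq) E₁(ω²q) = E₃⁴/E₉ gives P³ = E₁¹²/E₃³ + 27 q E₃⁹.  Hence Y = q E₉³/E₁³ and
-- t = q E₃¹²/E₁¹² satisfy Y³ = V t · (1 + 9 Y + 27 Y²), so that U(Yⁱ) = Σ_j m(i,j) tʲ.  Since V t · t = Y⁴,
-- dividing by tˡ yields U(tˡ) = Σ_k m(4l,l+k) tᵏ and U(Y² tˡ) = Σ_k m(4l+2,l+k) tᵏ.  In the
-- theorem, q times the right-hand sides are E₃⁻⁶ Σ_l c(2j-1,l) tˡ and E₁⁻⁶ Σ_l c(2j,l) tˡ; U takes the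
-- first to the second, and q² times the second to the next first one because q² E₁⁻⁶ = Y² E₉⁻⁶.

module Submission where

open import Defs
open import Data.Nat using (ℕ; _≤_; _*_; _+_; _∸_; _^_; _/_)
open import Data.Product using (_×_)
open import Relation.Binary.PropositionalEquality using (_≡_)

open import Algebra.Bundles using (CommutativeRing)
open import Algebra.Structures using (IsCommutativeRing)
open import Algebra.Solver.Ring.AlmostCommutativeRing
  using (fromCommutativeRing; _-Raw-AlmostCommutative⟶_)
import Algebra.Solver.Ring
open import Data.Bool using (Bool; true; false; if_then_else_)
open import Data.Integer as ℤ using (ℤ; +_)
import Data.Integer.Properties as ℤ
open import Data.Maybe using (Maybe; just; nothing)
open import Data.Nat as ℕ using (zero; suc; z≤n; s≤s)
open import Data.Nat.Divisibility using (n∣m*n)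
open import Data.Nat.DivMod using (+-distrib-/-∣ˡ; m*n/n≡m; [m+kn]%n≡m%n)
import Data.Nat.Properties as ℕ
open import Data.Nat.Solver using () renaming (module +-*-Solver to ℕSolver)
open import Data.Product using (_,_; proj₁; proj₂)
open import Data.Sum using (inj₁; inj₂)
open import Level using (0ℓ)
open import Relation.Binary.Bundles using (Setoid)
open import Relation.Binary.PropositionalEquality
  using (refl; sym; trans; cong; cong₂; subst; module ≡-Reasoning)
import Relation.Binary.Reasoning.Setoid as SetoidReasoning
open import Relation.Nullary using (yes; no)

-- The ring of power series

-- The integers contain no primitive cube root of unity. The product of the conjugates of a series
-- is therefore the determinant of multiplication by it on the basis 1, q, q² over the series in q³,
-- and its multiplicativity is a polynomial identity. An infinite product is known only through its
-- partial products. The norm formula and Jacobi's formula are thus proved for finite products and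
-- transferred modulo every power of q; for Jacobi's formula the finite product carries an auxiliary
-- variable z and is differentiated at z = 1. The recursion for m is the cubic relation for Y seen
-- through U: U(Yⁱ) = t (27 U(Yⁱ⁻¹) + 9 U(Yⁱ⁻²) + U(Yⁱ⁻³)). Its first column 9, 6, 1 comes from U(Y)
-- = 9 t, U(Y²) = 6 t + 243 t² and U(1) = 1.

sumℤ-suc : ∀ n (f : ℕ → ℤ) → sumℤ (suc n) f ≡ f 0 ℤ.+ sumℤ n (λ i → f (suc i))
sumℤ-suc zero    f = refl
sumℤ-suc (suc n) f = trans (cong (ℤ._+ f (suc (suc n))) (sumℤ-suc n f)) (ℤ.+-assoc (f 0) _ _)

sumℤ-cong-≤ : ∀ n {f g : ℕ → ℤ} → (∀ i → i ℕ.≤ n → f i ≡ g i) → sumℤ n f ≡ sumℤ n g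
sumℤ-cong-≤ zero    h = h 0 z≤n
sumℤ-cong-≤ (suc n) h =
  cong₂ ℤ._+_ (sumℤ-cong-≤ n (λ i i≤n → h i (ℕ.m≤n⇒m≤1+n i≤n))) (h (suc n) ℕ.≤-refl)

sumℤ-cong : ∀ n {f g : ℕ → ℤ} → (∀ i → f i ≡ g i) → sumℤ n f ≡ sumℤ n g
sumℤ-cong n h = sumℤ-cong-≤ n (λ i _ → h i)

sumℤ-+ : ∀ n (f g : ℕ → ℤ) → sumℤ n (λ i → f i ℤ.+ g i) ≡ sumℤ n f ℤ.+ sumℤ n g
sumℤ-+ zero    f g = refl
sumℤ-+ (suc n) f g = trans (cong (ℤ._+ (f (suc n) ℤ.+ g (suc n))) (sumℤ-+ n f g))
  (solve 4 (λ a b c d → (a :+ b) :+ (c :+ d) := (a :+ c) :+ (b :+ d)) refl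
    (sumℤ n f) (sumℤ n g) (f (suc n)) (g (suc n)))
  where open import Data.Integer.Solver; open +-*-Solver

sumℤ-*ˡ : ∀ n a (f : ℕ → ℤ) → sumℤ n (λ i → a ℤ.* f i) ≡ a ℤ.* sumℤ n f
sumℤ-*ˡ zero    a f = refl
sumℤ-*ˡ (suc n) a f =
  trans (cong (ℤ._+ a ℤ.* f (suc n)) (sumℤ-*ˡ n a f)) (sym (ℤ.*-distribˡ-+ a (sumℤ n f) (f (suc n))))

sumℤ-0 : ∀ n {f : ℕ → ℤ} → (∀ i → f i ≡ + 0) → sumℤ n f ≡ + 0
sumℤ-0 zero    h = h 0
sumℤ-0 (suc n) h = cong₂ ℤ._+_ (sumℤ-0 n h) (h (suc n))

sumℤ-swap : ∀ k n (f : ℕ → ℕ → ℤ) →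
  sumℤ k (λ i → sumℤ n (f i)) ≡ sumℤ n (λ j → sumℤ k (λ i → f i j))
sumℤ-swap zero    n f = refl
sumℤ-swap (suc k) n f =
  trans (cong (ℤ._+ sumℤ n (f (suc k))) (sumℤ-swap k n f)) (sym (sumℤ-+ n _ (f (suc k))))

sumℤ-extend : ∀ {k n} (f : ℕ → ℤ) → k ℕ.≤ n → (∀ i → k ℕ.< i → f i ≡ + 0) →
  sumℤ n f ≡ sumℤ k f
sumℤ-extend {k} {zero} f z≤n h = refl
sumℤ-extend {k} {suc n} f k≤n h with k ℕ.≟ suc n
... | yes refl = refl
... | no k≢n = trans
  (cong₂ ℤ._+_ (sumℤ-extend f (ℕ.≤-pred (ℕ.≤∧≢⇒< k≤n k≢n)) h) (h (suc n) (ℕ.≤∧≢⇒< k≤n k≢n)))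
  (ℤ.+-identityʳ _)

tail : Series → Series
tail f n = f (suc n)

⊛-suc : ∀ f g n → (f ⊛ g) (suc n) ≡ f 0 ℤ.* g (suc n) ℤ.+ (tail f ⊛ g) n
⊛-suc f g n = sumℤ-suc n _

⊛-sucʳ : ∀ f g n → (f ⊛ g) (suc n) ≡ (f ⊛ tail g) n ℤ.+ f (suc n) ℤ.* g 0
⊛-sucʳ f g n = cong₂ ℤ._+_
  (sumℤ-cong-≤ n (λ i i≤n → cong (λ k → f i ℤ.* g k) (ℕ.+-∸-assoc 1 i≤n)))
  (cong (λ k → f (suc n) ℤ.* g k) (ℕ.n∸n≡0 n))

⊛-cong-≤ : ∀ {f f′ g g′} n → (∀ i → i ℕ.≤ n → f i ≡ f′ i) → (∀ i → i ℕ.≤ n → g i ≡ g′ i) →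
  (f ⊛ g) n ≡ (f′ ⊛ g′) n
⊛-cong-≤ n p q = sumℤ-cong-≤ n (λ i i≤n → cong₂ ℤ._*_ (p i i≤n) (q (n ∸ i) (ℕ.m∸n≤m n i)))

⊛-comm : ∀ f g n → (f ⊛ g) n ≡ (g ⊛ f) n
⊛-comm f g zero    = ℤ.*-comm (f 0) (g 0)
⊛-comm f g (suc n) = begin
  (f ⊛ g) (suc n)                          ≡⟨ ⊛-suc f g n ⟩
  f 0 ℤ.* g (suc n) ℤ.+ (tail f ⊛ g) n     ≡⟨ cong₂ ℤ._+_ (ℤ.*-comm (f 0) _) (⊛-comm (tail f) g n) ⟩
  g (suc n) ℤ.* f 0 ℤ.+ (g ⊛ tail f) n     ≡⟨ ℤ.+-comm _ ((g ⊛ tail f) n) ⟩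
  (g ⊛ tail f) n ℤ.+ g (suc n) ℤ.* f 0     ≡⟨ ⊛-sucʳ g f n ⟨
  (g ⊛ f) (suc n)                          ∎
  where open ≡-Reasoning

⊛-distribʳ : ∀ h f g n → ((λ i → f i ℤ.+ g i) ⊛ h) n ≡ (f ⊛ h) n ℤ.+ (g ⊛ h) n
⊛-distribʳ h f g n = trans
  (sumℤ-cong n (λ i → ℤ.*-distribʳ-+ (h (n ∸ i)) (f i) (g i)))
  (sumℤ-+ n _ _)

⊛-scaleˡ : ∀ a f g n → ((λ i → a ℤ.* f i) ⊛ g) n ≡ a ℤ.* (f ⊛ g) n
⊛-scaleˡ a f g n = trans
  (sumℤ-cong n (λ i → ℤ.*-assoc a (f i) (g (n ∸ i))))
  (sumℤ-*ˡ n a _)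

⊛-assoc : ∀ f g h n → ((f ⊛ g) ⊛ h) n ≡ (f ⊛ (g ⊛ h)) n
⊛-assoc f g h zero    = ℤ.*-assoc (f 0) (g 0) (h 0)
⊛-assoc f g h (suc n) = begin
  ((f ⊛ g) ⊛ h) (suc n)
    ≡⟨ ⊛-suc (f ⊛ g) h n ⟩
  f₀ ℤ.* g 0 ℤ.* hₙ ℤ.+ (tail (f ⊛ g) ⊛ h) n
    ≡⟨ cong (λ x → f₀ ℤ.* g 0 ℤ.* hₙ ℤ.+ x) (⊛-cong-≤ {g = h} n (λ i _ → ⊛-suc f g i) (λ _ _ → refl)) ⟩
  f₀ ℤ.* g 0 ℤ.* hₙ ℤ.+ ((λ i → f₀ ℤ.* tail g i ℤ.+ (tail f ⊛ g) i) ⊛ h) n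
    ≡⟨ cong (λ x → f₀ ℤ.* g 0 ℤ.* hₙ ℤ.+ x) (⊛-distribʳ h (λ i → f₀ ℤ.* tail g i) (tail f ⊛ g) n) ⟩
  f₀ ℤ.* g 0 ℤ.* hₙ ℤ.+ (((λ i → f₀ ℤ.* tail g i) ⊛ h) n ℤ.+ ((tail f ⊛ g) ⊛ h) n)
    ≡⟨ cong (λ x → f₀ ℤ.* g 0 ℤ.* hₙ ℤ.+ x)
         (cong₂ ℤ._+_ (⊛-scaleˡ f₀ (tail g) h n) (⊛-assoc (tail f) g h n)) ⟩
  f₀ ℤ.* g 0 ℤ.* hₙ ℤ.+ (f₀ ℤ.* (tail g ⊛ h) n ℤ.+ (tail f ⊛ (g ⊛ h)) n)
    ≡⟨ solve 5 (λ f₀ g₀ hₙ u v → f₀ :* g₀ :* hₙ :+ (f₀ :* u :+ v) := f₀ :* (g₀ :* hₙ :+ u) :+ v) refl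
         f₀ (g 0) hₙ ((tail g ⊛ h) n) ((tail f ⊛ (g ⊛ h)) n) ⟩
  f₀ ℤ.* (g 0 ℤ.* hₙ ℤ.+ (tail g ⊛ h) n) ℤ.+ (tail f ⊛ (g ⊛ h)) n
    ≡⟨ cong (λ x → f₀ ℤ.* x ℤ.+ (tail f ⊛ (g ⊛ h)) n) (⊛-suc g h n) ⟨
  f₀ ℤ.* (g ⊛ h) (suc n) ℤ.+ (tail f ⊛ (g ⊛ h)) n
    ≡⟨ ⊛-suc f (g ⊛ h) n ⟨
  (f ⊛ (g ⊛ h)) (suc n) ∎
  where
  open ≡-Reasoning
  open import Data.Integer.Solver
  open +-*-Solver
  f₀ = f 0
  hₙ = h (suc n)

⊛-zeroˡ : ∀ f n → ((λ _ → + 0) ⊛ f) n ≡ + 0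
⊛-zeroˡ f n = sumℤ-0 n (λ i → ℤ.*-zeroˡ (f (n ∸ i)))

⊛-identityˡ : ∀ f n → (one ⊛ f) n ≡ f n
⊛-identityˡ f zero    = ℤ.*-identityˡ (f 0)
⊛-identityˡ f (suc n) = trans (⊛-suc one f n)
  (trans (cong₂ ℤ._+_ (ℤ.*-identityˡ (f (suc n))) (⊛-zeroˡ f n)) (ℤ.+-identityʳ _))

infix 4 _≈_
-- A record rather than a bare pointwise equality, so that unification can recover the two series
-- from the type.
record _≈_ (f g : Series) : Set where
  constructor ext
  field at : ∀ n → f n ≡ g n
open _≈_

-- Opaque copies of the operations keep Agda from unfolding a series into its coefficients.
infixl 6 _⊕_
infixl 7 _·_
infix 8 ⊖_
opaque
  _⊕_ _·_ : Series → Series → Series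
  (f ⊕ g) n = f n ℤ.+ g n
  _·_ = _⊛_

  ⊖_ : Series → Series
  (⊖ f) n = ℤ.- f n

  const : ℤ → Series
  const a zero    = a
  const a (suc n) = + 0

opaque
  unfolding _⊕_

  ⊕-at : ∀ f g n → (f ⊕ g) n ≡ f n ℤ.+ g n
  ⊕-at f g n = refl

  ⊛≈· : ∀ f g → f ⊛ g ≈ f · g
  ⊛≈· f g = ext λ _ → refl

  const-· : ∀ a f n → (const a · f) n ≡ a ℤ.* f n
  const-· a f zero    = refl
  const-· a f (suc n) = trans (⊛-suc (const a) f n)
    (trans (cong (λ x → a ℤ.* f (suc n) ℤ.+ x) (⊛-zeroˡ f n)) (ℤ.+-identityʳ _))

  const-0 : ∀ n → const (+ 0) n ≡ + 0
  const-0 zero    = refl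
  const-0 (suc n) = refl

  const-1 : const (+ 1) ≈ one
  const-1 = ext λ { zero → refl ; (suc n) → refl }

  const-+ : ∀ a b → const (a ℤ.+ b) ≈ const a ⊕ const b
  const-+ a b = ext λ { zero → refl ; (suc n) → refl }

  const-* : ∀ a b → const (a ℤ.* b) ≈ const a · const b
  const-* a b = ext λ
    { zero → refl
    ; (suc n) → sym (trans (const-· a (const b) (suc n)) (ℤ.*-zeroʳ a)) }

  const-neg : ∀ a → const (ℤ.- a) ≈ ⊖ const a
  const-neg a = ext λ { zero → refl ; (suc n) → refl }

  isCommutativeRing : IsCommutativeRing _≈_ _⊕_ _·_ ⊖_ (const (+ 0)) one
  isCommutativeRing = record
    { isRing = record
      { +-isAbelianGroup = record
        { isGroup = record
          { isMonoid = record
            { isSemigroup = record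
              { isMagma = record
                { isEquivalence = record
                  { refl = ext λ _ → refl
                  ; sym = λ p → ext λ n → sym (at p n)
                  ; trans = λ p q → ext λ n → trans (at p n) (at q n) }
                ; ∙-cong = λ p q → ext λ n → cong₂ ℤ._+_ (at p n) (at q n) }
              ; assoc = λ f g h → ext λ n → ℤ.+-assoc (f n) (g n) (h n) }
            ; identity = (λ f → ext λ n → trans (cong (ℤ._+ f n) (const-0 n)) (ℤ.+-identityˡ (f n)))
                       , (λ f → ext λ n → trans (cong (λ x → f n ℤ.+ x) (const-0 n)) (ℤ.+-identityʳ (f n))) }
          ; inverse = (λ f → ext λ n → trans (ℤ.+-inverseˡ (f n)) (sym (const-0 n)))
                    , (λ f → ext λ n → trans (ℤ.+-inverseʳ (f n)) (sym (const-0 n)))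
          ; ⁻¹-cong = λ p → ext λ n → cong ℤ.-_ (at p n) }
        ; comm = λ f g → ext λ n → ℤ.+-comm (f n) (g n) }
      ; *-cong = λ p q → ext λ n → ⊛-cong-≤ n (λ i _ → at p i) (λ i _ → at q i)
      ; *-assoc = λ f g h → ext (⊛-assoc f g h)
      ; *-identity = (λ f → ext (⊛-identityˡ f))
                   , (λ f → ext λ n → trans (⊛-comm f one n) (⊛-identityˡ f n))
      ; distrib = (λ f g h → ext λ n → trans (⊛-comm f (g ⊕ h) n)
                    (trans (⊛-distribʳ f g h n) (cong₂ ℤ._+_ (⊛-comm g f n) (⊛-comm h f n))))
                , (λ f g h → ext (⊛-distribʳ f g h)) }
    ; *-comm = λ f g → ext (⊛-comm f g) }

  ·-cong-≤ : ∀ {f f′ g g′} n → (∀ i → i ℕ.≤ n → f i ≡ f′ i) → (∀ i → i ℕ.≤ n → g i ≡ g′ i) →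
    (f · g) n ≡ (f′ · g′) n
  ·-cong-≤ {f} {f′} {g} {g′} = ⊛-cong-≤ {f} {f′} {g} {g′}

seriesRing : CommutativeRing 0ℓ 0ℓ
seriesRing = record { isCommutativeRing = isCommutativeRing }

open CommutativeRing seriesRing
  using (setoid)
  renaming (refl to ≈-refl; sym to ≈-sym; trans to ≈-trans; *-cong to ·-cong; +-cong to ⊕-cong;
            *-congˡ to ·-congˡ; *-congʳ to ·-congʳ; +-congˡ to ⊕-congˡ; +-congʳ to ⊕-congʳ; -‿cong to ⊖-cong;
            *-assoc to ·-assoc; *-identityˡ to ·-identityˡ; *-identityʳ to ·-identityʳ;
            zeroˡ to ·-zeroˡ; zeroʳ to ·-zeroʳ; +-identityʳ to ⊕-identityʳ; +-identityˡ to ⊕-identityˡ;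
            distribʳ to ·-distribʳ)
open import Algebra.Properties.CommutativeSemiring.Exp (CommutativeRing.commutativeSemiring seriesRing)
  using () renaming (_^_ to _↑_; ^-congˡ to ↑-congˡ; ^-congʳ to ↑-congʳ; ^-homo-* to ↑-homo-·; ^-assocʳ to ↑-assocʳ;
                     ^-distrib-* to ↑-distrib-·)

constHom : ℤ.+-*-rawRing -Raw-AlmostCommutative⟶ fromCommutativeRing seriesRing
constHom = record
  { ⟦_⟧ = const
  ; +-homo = const-+
  ; *-homo = const-*
  ; -‿homo = const-neg
  ; 0-homo = ≈-refl
  ; 1-homo = const-1 }

private
  _≟c_ : ∀ a b → Maybe (const a ≈ const b)
  a ≟c b with a ℤ.≟ b
  ... | yes refl = just ≈-refl
  ... | no _     = nothing

module SeriesSolver = Algebra.Solver.Ring ℤ.+-*-rawRing (fromCommutativeRing seriesRing) constHom _≟c_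

-- ⟦_⟧ sends it to one, whereas con (+ 1) denotes const (+ 1).
:1 : ∀ {n} → SeriesSolver.Polynomial n
:1 = SeriesSolver._:^_ (SeriesSolver.con (+ 1)) 0

open SeriesSolver using (solve; con; _:=_; _:+_; _:*_; :-_; _:-_; _:^_; Polynomial)

-- Sections of power series modulo 3

X : Series
X zero          = + 0
X (suc zero)    = + 1
X (suc (suc _)) = + 0

opaque
  unfolding _⊕_

  X·-zero : ∀ f → (X · f) 0 ≡ + 0
  X·-zero f = ℤ.*-zeroˡ (f 0)

  X·-suc : ∀ f n → (X · f) (suc n) ≡ f n
  X·-suc f n = trans (⊛-suc X f n)
    (trans (cong₂ ℤ._+_ (ℤ.*-zeroˡ (f (suc n)))
              (⊛-cong-≤ {tail X} {one} {f} n (λ { zero _ → refl ; (suc _) _ → refl }) (λ _ _ → refl)))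
      (trans (ℤ.+-identityˡ ((one ⊛ f) n)) (⊛-identityˡ f n)))

X·-cancel : ∀ {f g} → X · f ≈ X · g → f ≈ g
X·-cancel {f} {g} p = ext λ n → trans (sym (X·-suc f n)) (trans (at p (suc n)) (X·-suc g n))

-- V is the substitution q ↦ q³, and U r keeps the coefficients of the q^(3n+r).

V : Series → Series
V f zero                = f 0
V f (suc zero)          = + 0
V f (suc (suc zero))    = + 0
V f (suc (suc (suc n))) = V (tail f) n

opaque
  U : ℕ → Series → Series
  U r f n = f (r ℕ.+ n ℕ.* 3)

  U-at : ∀ r f n → U r f n ≡ f (r ℕ.+ n ℕ.* 3)
  U-at r f n = refl

  U-cong : ∀ r {f g} → f ≈ g → U r f ≈ U r g
  U-cong r p = ext λ n → at p _

V-0 : ∀ f n → V f (n ℕ.* 3) ≡ f n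
V-0 f zero    = refl
V-0 f (suc n) = V-0 (tail f) n

V-1 : ∀ f n → V f (1 ℕ.+ n ℕ.* 3) ≡ + 0
V-1 f zero    = refl
V-1 f (suc n) = V-1 (tail f) n

V-2 : ∀ f n → V f (2 ℕ.+ n ℕ.* 3) ≡ + 0
V-2 f zero    = refl
V-2 f (suc n) = V-2 (tail f) n

opaque
  unfolding U _⊕_

  U0-V : ∀ f → U 0 (V f) ≈ f
  U0-V f = ext (V-0 f)

  U1-V : ∀ f → U 1 (V f) ≈ const (+ 0)
  U1-V f = ext λ n → trans (V-1 f n) (sym (const-0 n))

  U2-V : ∀ f → U 2 (V f) ≈ const (+ 0)
  U2-V f = ext λ n → trans (V-2 f n) (sym (const-0 n))

  U0-X : ∀ f → U 0 (X · f) ≈ X · U 2 f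
  U0-X f = ext λ
    { zero → trans (X·-zero f) (sym (X·-zero (U 2 f)))
    ; (suc n) → trans (X·-suc f (2 ℕ.+ n ℕ.* 3)) (sym (X·-suc (U 2 f) n)) }

  U1-X : ∀ f → U 1 (X · f) ≈ U 0 f
  U1-X f = ext λ n → X·-suc f (n ℕ.* 3)

  U2-X : ∀ f → U 2 (X · f) ≈ U 1 f
  U2-X f = ext λ n → X·-suc f (1 ℕ.+ n ℕ.* 3)

  U-⊕ : ∀ r f g → U r (f ⊕ g) ≈ U r f ⊕ U r g
  U-⊕ r f g = ext λ _ → refl

  U-ext : ∀ {f g} → U 0 f ≈ U 0 g → U 1 f ≈ U 1 g → U 2 f ≈ U 2 g → f ≈ g
  U-ext {f} {g} p₀ p₁ p₂ = ext (go f g (at p₀) (at p₁) (at p₂))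
    where
    go : ∀ (f g : Series) → (∀ n → f (n ℕ.* 3) ≡ g (n ℕ.* 3)) → (∀ n → f (1 ℕ.+ n ℕ.* 3) ≡ g (1 ℕ.+ n ℕ.* 3)) →
      (∀ n → f (2 ℕ.+ n ℕ.* 3) ≡ g (2 ℕ.+ n ℕ.* 3)) → ∀ n → f n ≡ g n
    go f g p₀ p₁ p₂ zero                = p₀ 0
    go f g p₀ p₁ p₂ (suc zero)          = p₁ 0
    go f g p₀ p₁ p₂ (suc (suc zero))    = p₂ 0
    go f g p₀ p₁ p₂ (suc (suc (suc n))) =
      go (λ i → f (3 ℕ.+ i)) (λ i → g (3 ℕ.+ i))
        (λ i → p₀ (suc i)) (λ i → p₁ (suc i)) (λ i → p₂ (suc i)) n

sumℤ-0-mod-3 : ∀ n {f : ℕ → ℤ} → (∀ k → f (1 ℕ.+ k ℕ.* 3) ≡ + 0) → (∀ k → f (2 ℕ.+ k ℕ.* 3) ≡ + 0) →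
  sumℤ (n ℕ.* 3) f ≡ sumℤ n (λ k → f (k ℕ.* 3))
sumℤ-0-mod-3 zero    p q = refl
sumℤ-0-mod-3 (suc n) {f} p q = cong (ℤ._+ f (suc n ℕ.* 3)) (begin
  sumℤ (n ℕ.* 3) f ℤ.+ f (1 ℕ.+ n ℕ.* 3) ℤ.+ f (2 ℕ.+ n ℕ.* 3) ≡⟨ cong₂ (λ x y → sumℤ (n ℕ.* 3) f ℤ.+ x ℤ.+ y) (p n) (q n) ⟩
  sumℤ (n ℕ.* 3) f ℤ.+ + 0 ℤ.+ + 0                             ≡⟨ trans (ℤ.+-identityʳ _) (ℤ.+-identityʳ _) ⟩
  sumℤ (n ℕ.* 3) f                                             ≡⟨ sumℤ-0-mod-3 n p q ⟩
  sumℤ n (λ k → f (k ℕ.* 3))                                   ∎)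
  where open ≡-Reasoning

opaque
  unfolding U _⊕_

  private
    -- Only the indices divisible by 3 contribute to a convolution with `V f`. For r = 1, 2 the full
    -- coefficient has one or two further terms, which `U1-V·` and `U2-V·` discard.
    V⊛-at : ∀ f g r n →
      sumℤ (n ℕ.* 3) (λ k → V f k ℤ.* g (r ℕ.+ n ℕ.* 3 ∸ k)) ≡ (f ⊛ U r g) n
    V⊛-at f g r n = trans
      (sumℤ-0-mod-3 n (λ k → cong (ℤ._* g (r ℕ.+ n ℕ.* 3 ∸ (1 ℕ.+ k ℕ.* 3))) (V-1 f k))
                      (λ k → cong (ℤ._* g (r ℕ.+ n ℕ.* 3 ∸ (2 ℕ.+ k ℕ.* 3))) (V-2 f k)))
      (sumℤ-cong-≤ n λ k k≤n → cong₂ (λ x i → x ℤ.* g i) (V-0 f k)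
        (trans (ℕ.+-∸-assoc r (ℕ.*-monoˡ-≤ 3 k≤n)) (cong (r ℕ.+_) (sym (ℕ.*-distribʳ-∸ 3 n k)))))

  U0-V· : ∀ f g → U 0 (V f · g) ≈ f · U 0 g
  U0-V· f g = ext (V⊛-at f g 0)

  U1-V· : ∀ f g → U 1 (V f · g) ≈ f · U 1 g
  U1-V· f g = ext λ n → trans
    (cong₂ ℤ._+_ (V⊛-at f g 1 n) (cong (ℤ._* g (n ℕ.* 3 ∸ n ℕ.* 3)) (V-1 f n))) (ℤ.+-identityʳ ((f ⊛ U 1 g) n))

  U2-V· : ∀ f g → U 2 (V f · g) ≈ f · U 2 g
  U2-V· f g = ext λ n → begin
    S n ℤ.+ V f (1 ℕ.+ n ℕ.* 3) ℤ.* g (1 ℕ.+ n ℕ.* 3 ∸ n ℕ.* 3) ℤ.+ V f (2 ℕ.+ n ℕ.* 3) ℤ.* g (n ℕ.* 3 ∸ n ℕ.* 3)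
      ≡⟨ cong₂ (λ x y → S n ℤ.+ x ℤ.* g (1 ℕ.+ n ℕ.* 3 ∸ n ℕ.* 3) ℤ.+ y ℤ.* g (n ℕ.* 3 ∸ n ℕ.* 3)) (V-1 f n) (V-2 f n) ⟩
    S n ℤ.+ + 0 ℤ.+ + 0
      ≡⟨ trans (ℤ.+-identityʳ (S n ℤ.+ + 0)) (ℤ.+-identityʳ (S n)) ⟩
    S n
      ≡⟨ V⊛-at f g 2 n ⟩
    (f ⊛ U 2 g) n ∎
    where
    open ≡-Reasoning
    S : ℕ → ℤ
    S n = sumℤ (n ℕ.* 3) (λ k → V f k ℤ.* g (2 ℕ.+ n ℕ.* 3 ∸ k))

  V-cong : ∀ {f g} → f ≈ g → V f ≈ V g
  V-cong {f} {g} p = U-ext (≈-trans (U0-V f) (≈-trans p (≈-sym (U0-V g))))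
    (≈-trans (U1-V f) (≈-sym (U1-V g))) (≈-trans (U2-V f) (≈-sym (U2-V g)))

  V-⊕ : ∀ f g → V (f ⊕ g) ≈ V f ⊕ V g
  V-⊕ f g = U-ext
    (ext λ n → trans (V-0 (f ⊕ g) n) (sym (cong₂ ℤ._+_ (V-0 f n) (V-0 g n))))
    (ext λ n → trans (V-1 (f ⊕ g) n) (sym (cong₂ ℤ._+_ (V-1 f n) (V-1 g n))))
    (ext λ n → trans (V-2 (f ⊕ g) n) (sym (cong₂ ℤ._+_ (V-2 f n) (V-2 g n))))

  V-⊖ : ∀ f → V (⊖ f) ≈ ⊖ V f
  V-⊖ f = U-ext
    (ext λ n → trans (V-0 (⊖ f) n) (sym (cong ℤ.-_ (V-0 f n))))
    (ext λ n → trans (V-1 (⊖ f) n) (sym (cong ℤ.-_ (V-1 f n))))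
    (ext λ n → trans (V-2 (⊖ f) n) (sym (cong ℤ.-_ (V-2 f n))))

  V-const : ∀ a → V (const a) ≈ const a
  V-const a = U-ext
    (ext λ { zero → refl ; (suc n) → V-0 (const a) (suc n) })
    (ext λ n → V-1 (const a) n)
    (ext λ n → V-2 (const a) n)

V-one : V one ≈ one
V-one = ≈-trans (V-cong (≈-sym const-1)) (≈-trans (V-const (+ 1)) const-1)

V-· : ∀ f g → V (f · g) ≈ V f · V g
V-· f g = U-ext
  (≈-trans (U0-V (f · g)) (≈-sym (≈-trans (U0-V· f (V g)) (·-congˡ (U0-V g)))))
  (≈-trans (U1-V (f · g)) (≈-sym (≈-trans (U1-V· f (V g)) (≈-trans (·-congˡ (U1-V g)) (·-zeroʳ f)))))
  (≈-trans (U2-V (f · g)) (≈-sym (≈-trans (U2-V· f (V g)) (≈-trans (·-congˡ (U2-V g)) (·-zeroʳ f)))))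

V-↑ : ∀ f n → V (f ↑ n) ≈ V f ↑ n
V-↑ f zero    = V-one
V-↑ f (suc n) = ≈-trans (V-· f (f ↑ n)) (·-congˡ (V-↑ f n))

U0-one : U 0 one ≈ one
U0-one = ≈-trans (U-cong 0 (≈-sym V-one)) (U0-V one)

U1-one : U 1 one ≈ const (+ 0)
U1-one = ≈-trans (U-cong 1 (≈-sym V-one)) (U1-V one)

U2-one : U 2 one ≈ const (+ 0)
U2-one = ≈-trans (U-cong 2 (≈-sym V-one)) (U2-V one)

U0-X·V : ∀ f → U 0 (X · V f) ≈ const (+ 0)
U0-X·V f = ≈-trans (U0-X (V f)) (≈-trans (·-congˡ (U2-V f)) (·-zeroʳ X))

U0-X·X·V : ∀ f → U 0 (X · (X · V f)) ≈ const (+ 0)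
U0-X·X·V f = ≈-trans (U0-X (X · V f)) (≈-trans (·-congˡ (≈-trans (U2-X (V f)) (U1-V f))) (·-zeroʳ X))

U2-X·X·V : ∀ f → U 2 (X · (X · V f)) ≈ f
U2-X·X·V f = ≈-trans (U2-X (X · V f)) (≈-trans (U1-X (V f)) (U0-V f))

-- The series V f₀ + q V f₁ + q² V f₂.
weave : Series → Series → Series → Series
weave f₀ f₁ f₂ = V f₀ ⊕ X · V f₁ ⊕ X · (X · V f₂)

private
  U-weave : ∀ r f₀ f₁ f₂ {g₀ g₁ g₂} → U r (V f₀) ≈ g₀ → U r (X · V f₁) ≈ g₁ → U r (X · (X · V f₂)) ≈ g₂ →
    U r (weave f₀ f₁ f₂) ≈ g₀ ⊕ g₁ ⊕ g₂
  U-weave r f₀ f₁ f₂ p₀ p₁ p₂ = ≈-trans (U-⊕ r _ _) (⊕-cong (≈-trans (U-⊕ r _ _) (⊕-cong p₀ p₁)) p₂)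

U0-weave : ∀ f₀ f₁ f₂ → U 0 (weave f₀ f₁ f₂) ≈ f₀
U0-weave f₀ f₁ f₂ = ≈-trans (U-weave 0 f₀ f₁ f₂ (U0-V f₀) (U0-X·V f₁) (U0-X·X·V f₂))
  (≈-trans (⊕-identityʳ _) (⊕-identityʳ f₀))

U1-weave : ∀ f₀ f₁ f₂ → U 1 (weave f₀ f₁ f₂) ≈ f₁
U1-weave f₀ f₁ f₂ = ≈-trans
  (U-weave 1 f₀ f₁ f₂ (U1-V f₀) (≈-trans (U1-X (V f₁)) (U0-V f₁))
    (≈-trans (U1-X (X · V f₂)) (U0-X·V f₂)))
  (≈-trans (⊕-identityʳ _) (⊕-identityˡ f₁))

U2-weave : ∀ f₀ f₁ f₂ → U 2 (weave f₀ f₁ f₂) ≈ f₂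
U2-weave f₀ f₁ f₂ = ≈-trans
  (U-weave 2 f₀ f₁ f₂ (U2-V f₀) (≈-trans (U2-X (V f₁)) (U1-V f₁)) (U2-X·X·V f₂))
  (≈-trans (⊕-congʳ (⊕-identityʳ _)) (⊕-identityˡ f₂))

weave-U : ∀ f → f ≈ weave (U 0 f) (U 1 f) (U 2 f)
weave-U f = U-ext (≈-sym (U0-weave _ _ _)) (≈-sym (U1-weave _ _ _)) (≈-sym (U2-weave _ _ _))

V-X : V X ≈ X · (X · X)
V-X = ≈-trans
  (U-ext
    (≈-trans (U0-V X) (≈-sym (≈-trans (U0-X _) (≈-trans (·-congˡ (≈-trans (U2-X _) (≈-trans (U1-X one) U0-one)))
      (·-identityʳ X)))))
    (≈-trans (U1-V X) (≈-sym (≈-trans (U1-X _) (≈-trans (U0-X _) (≈-trans (·-congˡ (≈-trans (U2-X one) U1-one))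
      (·-zeroʳ X))))))
    (≈-trans (U2-V X) (≈-sym (≈-trans (U2-X _) (≈-trans (U1-X _) (≈-trans (U0-X one) (≈-trans (·-congˡ U2-one)
      (·-zeroʳ X))))))))
  (·-congˡ (·-congˡ (·-identityʳ X)))

-- Equality up to a given degree

infix 4 _≈[_]_
-- An infinite product agrees with a partial product only below a bounded degree, and this relation
-- records the bound; `≈-from-upTo` recovers full equality.
record _≈[_]_ (f : Series) (n : ℕ) (g : Series) : Set where
  constructor ext≤
  field at≤ : ∀ i → i ℕ.≤ n → f i ≡ g i
open _≈[_]_

upTo : ∀ {f g n} → f ≈ g → f ≈[ n ] g
upTo p = ext≤ λ i _ → at p i

≈-from-upTo : ∀ {f g} → (∀ n → f ≈[ n ] g) → f ≈ g
≈-from-upTo p = ext λ n → at≤ (p n) n ℕ.≤-refl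

upTo-≤ : ∀ {f g k n} → k ℕ.≤ n → f ≈[ n ] g → f ≈[ k ] g
upTo-≤ k≤n p = ext≤ λ i i≤k → at≤ p i (ℕ.≤-trans i≤k k≤n)

upToSetoid : ℕ → Setoid 0ℓ 0ℓ
upToSetoid n = record
  { Carrier = Series
  ; _≈_ = _≈[ n ]_
  ; isEquivalence = record
    { refl = ext≤ λ _ _ → refl
    ; sym = λ p → ext≤ λ i i≤n → sym (at≤ p i i≤n)
    ; trans = λ p q → ext≤ λ i i≤n → trans (at≤ p i i≤n) (at≤ q i i≤n) } }

module _ {n : ℕ} where
  open Setoid (upToSetoid n) public
    using () renaming (refl to ≈[]-refl; sym to ≈[]-sym; trans to ≈[]-trans)

opaque
  unfolding U _⊕_

  ⊕-upTo : ∀ {n f f′ g g′} → f ≈[ n ] f′ → g ≈[ n ] g′ → f ⊕ g ≈[ n ] f′ ⊕ g′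
  ⊕-upTo p q = ext≤ λ i i≤n → cong₂ ℤ._+_ (at≤ p i i≤n) (at≤ q i i≤n)

  ⊖-upTo : ∀ {n f f′} → f ≈[ n ] f′ → ⊖ f ≈[ n ] ⊖ f′
  ⊖-upTo p = ext≤ λ i i≤n → cong ℤ.-_ (at≤ p i i≤n)

  ·-upTo : ∀ {n f f′ g g′} → f ≈[ n ] f′ → g ≈[ n ] g′ → f · g ≈[ n ] f′ · g′
  ·-upTo p q = ext≤ λ i i≤n → ·-cong-≤ i (λ j j≤i → at≤ p j (ℕ.≤-trans j≤i i≤n))
                                         (λ j j≤i → at≤ q j (ℕ.≤-trans j≤i i≤n))

  U-upTo : ∀ {n f f′} r → f ≈[ r ℕ.+ n ℕ.* 3 ] f′ → U r f ≈[ n ] U r f′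
  U-upTo r p = ext≤ λ i i≤n → at≤ p (r ℕ.+ i ℕ.* 3) (ℕ.+-monoʳ-≤ r (ℕ.*-monoˡ-≤ 3 i≤n))

V-upTo : ∀ {n f f′} → f ≈[ n ] f′ → V f ≈[ n ] V f′
V-upTo {n} {f} {f′} p = ext≤ λ i i≤n → go f f′ i n i≤n (at≤ p)
  where
  go : ∀ f f′ i n → i ℕ.≤ n → (∀ j → j ℕ.≤ n → f j ≡ f′ j) → V f i ≡ V f′ i
  go f f′ zero                n       i≤n p = p 0 z≤n
  go f f′ (suc zero)          n       i≤n p = refl
  go f f′ (suc (suc zero))    n       i≤n p = refl
  go f f′ (suc (suc (suc i))) (suc n) (s≤s i≤n) p =
    go (tail f) (tail f′) i n (ℕ.≤-trans (ℕ.m≤n+m i 2) i≤n) (λ j j≤n → p (suc j) (s≤s j≤n))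

X↑·-upTo : ∀ n f → X ↑ suc n · f ≈[ n ] const (+ 0)
X↑·-upTo n f = ext≤ λ i i≤n → trans (go n i i≤n) (sym (const-0 i))
  where
  go : ∀ n i → i ℕ.≤ n → (X ↑ suc n · f) i ≡ + 0
  go n       zero    i≤n       = trans (at (·-assoc X (X ↑ n) f) 0) (X·-zero (X ↑ n · f))
  go (suc n) (suc i) (s≤s i≤n) = trans (at (·-assoc X (X ↑ suc n) f) (suc i))
    (trans (X·-suc (X ↑ suc n · f) i) (go n i i≤n))

-- Inverses and the products E

-- The list processors behind inv are private to Defs, so Dt, which has to be Defs.dot applied to the
-- list of inverse coefficients, is left to unification.  Abstracting over the literal 1 and over
-- negation turns the coefficient of the inverse into a pattern that determines Dt.

private
  dot-as-sum : (f : Series) (D : ℕ → ℕ → ℤ) →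
    (∀ k → D k 0 ≡ f k ℤ.* + 1 ℤ.+ + 0) →
    (∀ k n → D k (suc n) ≡ f k ℤ.* inv f (suc n) ℤ.+ D (suc k) n) →
    ∀ k n → D k n ≡ sumℤ n (λ i → f (k ℕ.+ i) ℤ.* inv f (n ∸ i))
  dot-as-sum f D z s k zero    = trans (z k)
    (trans (ℤ.+-identityʳ _) (cong (λ j → f j ℤ.* + 1) (sym (ℕ.+-identityʳ k))))
  dot-as-sum f D z s k (suc n) = trans (s k n) (trans
    (cong₂ ℤ._+_ (cong (λ j → f j ℤ.* inv f (suc n)) (sym (ℕ.+-identityʳ k)))
      (trans (dot-as-sum f D z s (suc k) n)
        (sumℤ-cong n (λ i → cong (λ j → f j ℤ.* inv f (n ∸ i)) (sym (ℕ.+-suc k i))))))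
    (sym (sumℤ-suc n (λ i → f (k ℕ.+ i) ℤ.* inv f (suc n ∸ i)))))

  mutual
    Dt : Series → ℕ → ℕ → ℤ
    Dt f k n = _

    inv-suc : ∀ f n k → k ≡ 1 → inv f (suc n) ≡ ℤ.- sumℤ n (λ i → f (k ℕ.+ i) ℤ.* inv f (n ∸ i))
    inv-suc f n k eq with ℤ.-_ | 1
    inv-suc f n k refl | neg | .k = cong neg (dot-as-sum f (Dt f) (λ _ → refl) (λ _ _ → refl) k n)

opaque
  unfolding _⊕_

  inv-inverseʳ : ∀ {f} → f 0 ≡ + 1 → f · inv f ≈ one
  inv-inverseʳ {f} f₀≡1 = ext λ
    { zero    → cong (ℤ._* + 1) f₀≡1
    ; (suc n) → begin
        (f ⊛ inv f) (suc n)                           ≡⟨ ⊛-suc f (inv f) n ⟩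
        f 0 ℤ.* inv f (suc n) ℤ.+ (tail f ⊛ inv f) n  ≡⟨ cong₂ (λ x y → x ℤ.* y ℤ.+ (tail f ⊛ inv f) n) f₀≡1 (inv-suc f n 1 refl) ⟩
        + 1 ℤ.* (ℤ.- (tail f ⊛ inv f) n) ℤ.+ (tail f ⊛ inv f) n
                                                      ≡⟨ cong (ℤ._+ (tail f ⊛ inv f) n) (ℤ.*-identityˡ (ℤ.- (tail f ⊛ inv f) n)) ⟩
        ℤ.- (tail f ⊛ inv f) n ℤ.+ (tail f ⊛ inv f) n ≡⟨ ℤ.+-inverseˡ ((tail f ⊛ inv f) n) ⟩
        + 0 ∎ }
    where open ≡-Reasoning

·-undo : ∀ {u v} → u · v ≈ one → ∀ h → v · (u · h) ≈ h
·-undo {u} {v} uv≈1 h = begin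
  v · (u · h)  ≈⟨ solve 3 (λ u v h → v :* (u :* h) := u :* v :* h) ≈-refl u v h ⟩
  u · v · h    ≈⟨ ·-congʳ uv≈1 ⟩
  one · h      ≈⟨ ·-identityˡ h ⟩
  h            ∎
  where open SetoidReasoning setoid

·-cancelˡ-upTo : ∀ {n u v} f g → u · v ≈ one → u · f ≈[ n ] u · g → f ≈[ n ] g
·-cancelˡ-upTo f g uv≈1 uf≈ug = ≈[]-trans (upTo (≈-sym (·-undo uv≈1 f)))
  (≈[]-trans (·-upTo ≈[]-refl uf≈ug) (upTo (·-undo uv≈1 g)))

·-cancelˡ : ∀ {u v} f g → u · v ≈ one → u · f ≈ u · g → f ≈ g
·-cancelˡ f g uv≈1 uf≈ug = ≈-from-upTo λ n → ·-cancelˡ-upTo f g uv≈1 (upTo uf≈ug)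

inv-unique : ∀ {f g} → f 0 ≡ + 1 → f · g ≈ one → inv f ≈ g
inv-unique {f} {g} f₀≡1 fg≈1 =
  ·-cancelˡ (inv f) g (inv-inverseʳ f₀≡1) (≈-trans (inv-inverseʳ f₀≡1) (≈-sym fg≈1))

pow≈↑ : ∀ f n → pow f n ≈ f ↑ n
pow≈↑ f zero    = ≈-refl
pow≈↑ f (suc n) = ≈-trans (⊛≈· f (pow f n)) (·-congˡ (pow≈↑ f n))

pow-0 : ∀ f n → f 0 ≡ + 1 → pow f n 0 ≡ + 1
pow-0 f zero    f₀≡1 = refl
pow-0 f (suc n) f₀≡1 = cong₂ ℤ._*_ f₀≡1 (pow-0 f n f₀≡1)

one↑ : ∀ n → one ↑ n ≈ one
one↑ zero    = ≈-refl
one↑ (suc n) = ≈-trans (·-identityˡ _) (one↑ n)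

↑-inverse : ∀ {f g} n → f · g ≈ one → f ↑ n · g ↑ n ≈ one
↑-inverse {f} {g} n fg≈1 = ≈-trans (≈-sym (↑-distrib-· f g n)) (≈-trans (↑-congˡ n fg≈1) (one↑ n))

opaque
  unfolding _⊕_

  oneMinusQ^≈ : ∀ m → oneMinusQ^ m ≈ one ⊕ ⊖ (X ↑ m)
  oneMinusQ^≈ m = ext λ n → cong (λ x → one n ℤ.+ ℤ.- x) (δ≡X↑ m n)
    where
    δ≡X↑ : ∀ m n → (if n ℕ.≡ᵇ m then + 1 else + 0) ≡ (X ↑ m) n
    δ≡X↑ zero    zero    = refl
    δ≡X↑ zero    (suc n) = refl
    δ≡X↑ (suc m) zero    = sym (X·-zero (X ↑ m))
    δ≡X↑ (suc m) (suc n) = trans (δ≡X↑ m n) (sym (X·-suc (X ↑ m) n))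

partialE-suc : ∀ j N → partialE j (suc N) ≈ partialE j N · (one ⊕ ⊖ (X ↑ (j ℕ.* suc N)))
partialE-suc j N = ≈-trans (⊛≈· (partialE j N) (oneMinusQ^ (j ℕ.* suc N))) (·-congˡ (oneMinusQ^≈ _))

X↑-upTo : ∀ {n k} → n ℕ.< k → X ↑ k ≈[ n ] const (+ 0)
X↑-upTo {n} {suc k} (s≤s n≤k) =
  upTo-≤ n≤k (≈[]-trans (upTo (≈-sym (·-identityʳ (X ↑ suc k)))) (X↑·-upTo k one))

one⊖X↑-upTo : ∀ {n k} → n ℕ.< k → one ⊕ ⊖ (X ↑ k) ≈[ n ] one
one⊖X↑-upTo n<k = ≈[]-trans (⊕-upTo ≈[]-refl (⊖-upTo (X↑-upTo n<k)))
  (upTo (solve 1 (λ x → x :- con (+ 0) := x) ≈-refl one))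

partialE-upTo : ∀ j {n N} → n ℕ.≤ N → partialE (suc j) N ≈[ n ] partialE (suc j) n
partialE-upTo j {n} {N} n≤N with ℕ.m≤n⇒m<n∨m≡n n≤N
... | inj₂ refl = ≈[]-refl
partialE-upTo j {n} {suc N} n≤N | inj₁ (s≤s n≤N′) = ≈[]-trans (upTo (partialE-suc (suc j) N))
  (≈[]-trans (·-upTo (partialE-upTo j n≤N′) (one⊖X↑-upTo (ℕ.≤-trans (s≤s n≤N′) (ℕ.m≤m+n (suc N) _))))
    (upTo (·-identityʳ _)))

E-upTo : ∀ j {n N} → n ℕ.≤ N → E (suc j) ≈[ n ] partialE (suc j) N
E-upTo j n≤N = ext≤ λ i i≤n → sym (at≤ (partialE-upTo j (ℕ.≤-trans i≤n n≤N)) i ℕ.≤-refl)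

V-X↑ : ∀ m → V (X ↑ m) ≈ X ↑ (3 ℕ.* m)
V-X↑ m = ≈-trans (V-↑ X m) (≈-trans (↑-congˡ m (≈-trans V-X (·-congˡ (·-congˡ (≈-sym (·-identityʳ X))))))
  (↑-assocʳ X 3 m))

V-one⊖ : ∀ f → V (one ⊕ ⊖ f) ≈ one ⊕ ⊖ V f
V-one⊖ f = ≈-trans (V-⊕ one (⊖ f)) (⊕-cong V-one (V-⊖ f))

V-partialE : ∀ j N → V (partialE j N) ≈ partialE (3 ℕ.* j) N
V-partialE j zero    = V-one
V-partialE j (suc N) = begin
  V (partialE j (suc N))                                             ≈⟨ V-cong (partialE-suc j N) ⟩
  V (partialE j N · (one ⊕ ⊖ (X ↑ (j ℕ.* suc N))))                   ≈⟨ V-· _ _ ⟩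
  V (partialE j N) · V (one ⊕ ⊖ (X ↑ (j ℕ.* suc N)))
    ≈⟨ ·-cong (V-partialE j N) (≈-trans (V-one⊖ _) (⊕-congˡ (⊖-cong (V-X↑ (j ℕ.* suc N))))) ⟩
  partialE (3 ℕ.* j) N · (one ⊕ ⊖ (X ↑ (3 ℕ.* (j ℕ.* suc N))))
    ≡⟨ cong (λ m → partialE (3 ℕ.* j) N · (one ⊕ ⊖ (X ↑ m))) (sym (ℕ.*-assoc 3 j (suc N))) ⟩
  partialE (3 ℕ.* j) N · (one ⊕ ⊖ (X ↑ (3 ℕ.* j ℕ.* suc N)))         ≈⟨ partialE-suc (3 ℕ.* j) N ⟨
  partialE (3 ℕ.* j) (suc N)                                         ∎
  where open SetoidReasoning setoid

V-E : ∀ j → V (E (suc j)) ≈ E (3 ℕ.* suc j)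
V-E j = ≈-from-upTo λ n → ≈[]-trans (V-upTo (E-upTo j ℕ.≤-refl))
  (≈[]-trans (upTo (V-partialE (suc j) n)) (≈[]-sym (E-upTo (j ℕ.+ 2 ℕ.* suc j) ℕ.≤-refl)))

-- The cubic norm

V-⊕-· : ∀ f₁ g₁ f₂ g₂ → V (f₁ · g₁ ⊕ f₂ · g₂) ≈ V f₁ · V g₁ ⊕ V f₂ · V g₂
V-⊕-· f₁ g₁ f₂ g₂ = ≈-trans (V-⊕ _ _) (⊕-cong (V-· f₁ g₁) (V-· f₂ g₂))

V-X· : ∀ f → V (X · f) ≈ X · (X · X) · V f
V-X· f = ≈-trans (V-· X f) (·-congʳ V-X)

-- Products of sections of total degree 3 and 4 in q carry over into the sections 0 and 1, which is
-- where the factors `X` come from.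
weave-· : ∀ a b c d e f → weave a b c · weave d e f ≈
  weave (a · d ⊕ X · (b · f ⊕ c · e)) (a · e ⊕ b · d ⊕ X · (c · f)) (a · f ⊕ b · e ⊕ c · d)
weave-· a b c d e f = ≈-sym (begin
  weave (a · d ⊕ X · (b · f ⊕ c · e)) (a · e ⊕ b · d ⊕ X · (c · f)) (a · f ⊕ b · e ⊕ c · d)
    ≈⟨ ⊕-cong (⊕-cong
         (≈-trans (V-⊕ _ _) (⊕-cong (V-· a d) (≈-trans (V-X· _) (·-congˡ (V-⊕-· b f c e)))))
         (·-congˡ (≈-trans (V-⊕ _ _) (⊕-cong (V-⊕-· a e b d) (≈-trans (V-X· _) (·-congˡ (V-· c f)))))))
         (·-congˡ (·-congˡ (≈-trans (V-⊕ _ _) (⊕-cong (V-⊕-· a f b e) (V-· c d))))) ⟩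
  V a · V d ⊕ X · (X · X) · (V b · V f ⊕ V c · V e)
    ⊕ X · (V a · V e ⊕ V b · V d ⊕ X · (X · X) · (V c · V f))
    ⊕ X · (X · (V a · V f ⊕ V b · V e ⊕ V c · V d))
    ≈⟨ solve 7 (λ x a b c d e f →
         a :* d :+ x :* (x :* x) :* (b :* f :+ c :* e)
           :+ x :* (a :* e :+ b :* d :+ x :* (x :* x) :* (c :* f))
           :+ x :* (x :* (a :* f :+ b :* e :+ c :* d))
         := (a :+ x :* b :+ x :* (x :* c)) :* (d :+ x :* e :+ x :* (x :* f)))
         ≈-refl X (V a) (V b) (V c) (V d) (V e) (V f) ⟩
  weave a b c · weave d e f ∎)
  where open SetoidReasoning setoid

-- norm₃ (U 0 f) (U 1 f) (U 2 f) is Π f(ωq) over the cube roots of unity ω, written in the variable q³.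

norm₃ : Series → Series → Series → Series
norm₃ a b c = a · a · a ⊕ X · (b · b · b) ⊕ X · X · (c · c · c) ⊕ ⊖ (const (+ 3) · X · a · b · c)

-- The arguments on the left are the sections of a product found in `weave-·`. The norm is a
-- determinant of a multiplication map, so it is multiplicative; the solver checks this as an
-- identity in `X` and six variables.
norm₃-· : ∀ a b c d e f →
  norm₃ (a · d ⊕ X · (b · f ⊕ c · e)) (a · e ⊕ b · d ⊕ X · (c · f)) (a · f ⊕ b · e ⊕ c · d)
    ≈ norm₃ a b c · norm₃ d e f
norm₃-· = solve 7
  (λ x a b c d e f →
    norm x (a :* d :+ x :* (b :* f :+ c :* e)) (a :* e :+ b :* d :+ x :* (c :* f)) (a :* f :+ b :* e :+ c :* d)
    := norm x a b c :* norm x d e f)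
  ≈-refl X
  where
  norm : ∀ {n} → (x a b c : Polynomial n) → Polynomial n
  norm x a b c =
    a :* a :* a :+ x :* (b :* b :* b) :+ x :* x :* (c :* c :* c) :+ :- (con (+ 3) :* x :* a :* b :* c)

norm₃-upTo : ∀ {n a b c a′ b′ c′} → a ≈[ n ] a′ → b ≈[ n ] b′ → c ≈[ n ] c′ →
  norm₃ a b c ≈[ n ] norm₃ a′ b′ c′
norm₃-upTo p q r = ⊕-upTo
  (⊕-upTo (⊕-upTo (·-upTo (·-upTo p p) p) (·-upTo ≈[]-refl (·-upTo (·-upTo q q) q)))
    (·-upTo ≈[]-refl (·-upTo (·-upTo r r) r)))
  (⊖-upTo (·-upTo (·-upTo (·-upTo ≈[]-refl p) q) r))

norm₃-cong : ∀ {a b c a′ b′ c′} → a ≈ a′ → b ≈ b′ → c ≈ c′ → norm₃ a b c ≈ norm₃ a′ b′ c′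
norm₃-cong p q r = ≈-from-upTo λ n → norm₃-upTo (upTo p) (upTo q) (upTo r)

Norm : Series → Series
Norm f = norm₃ (U 0 f) (U 1 f) (U 2 f)

Norm-cong : ∀ {f g} → f ≈ g → Norm f ≈ Norm g
Norm-cong p = norm₃-cong (U-cong 0 p) (U-cong 1 p) (U-cong 2 p)

Norm-weave : ∀ a b c → Norm (weave a b c) ≈ norm₃ a b c
Norm-weave a b c = norm₃-cong (U0-weave a b c) (U1-weave a b c) (U2-weave a b c)

-- The last section up to degree n reads coefficients up to 3n + 2.
Norm-upTo : ∀ {n f g} → f ≈[ 2 ℕ.+ n ℕ.* 3 ] g → Norm f ≈[ n ] Norm g
Norm-upTo p = norm₃-upTo (U-upTo 0 (upTo-≤ (ℕ.m≤n+m _ 2) p)) (U-upTo 1 (upTo-≤ (ℕ.n≤1+n _) p)) (U-upTo 2 p)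

Norm-· : ∀ f g → Norm (f · g) ≈ Norm f · Norm g
Norm-· f g = begin
  Norm (f · g)
    ≈⟨ Norm-cong (·-cong (weave-U f) (weave-U g)) ⟩
  Norm (weave (U 0 f) (U 1 f) (U 2 f) · weave (U 0 g) (U 1 g) (U 2 g))
    ≈⟨ Norm-cong (weave-· _ _ _ _ _ _) ⟩
  Norm (weave (U 0 f · U 0 g ⊕ X · (U 1 f · U 2 g ⊕ U 2 f · U 1 g))
              (U 0 f · U 1 g ⊕ U 1 f · U 0 g ⊕ X · (U 2 f · U 2 g))
              (U 0 f · U 2 g ⊕ U 1 f · U 1 g ⊕ U 2 f · U 0 g))
    ≈⟨ Norm-weave _ _ _ ⟩
  norm₃ (U 0 f · U 0 g ⊕ X · (U 1 f · U 2 g ⊕ U 2 f · U 1 g))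
        (U 0 f · U 1 g ⊕ U 1 f · U 0 g ⊕ X · (U 2 f · U 2 g))
        (U 0 f · U 2 g ⊕ U 1 f · U 1 g ⊕ U 2 f · U 0 g)
    ≈⟨ norm₃-· _ _ _ _ _ _ ⟩
  Norm f · Norm g ∎
  where open SetoidReasoning setoid

module _ (x : Series) where
  private
    V-0# : V (const (+ 0)) ≈ const (+ 0)
    V-0# = V-const (+ 0)

  -- A series in q³ equals its conjugates, so its norm is a cube.
  Norm-one⊖V : Norm (one ⊕ ⊖ V x) ≈ (one ⊕ ⊖ x) · (one ⊕ ⊖ x) · (one ⊕ ⊖ x)
  Norm-one⊖V = ≈-trans
    (Norm-cong (≈-sym (≈-trans (⊕-cong (⊕-cong (V-one⊖ x) (·-congˡ V-0#)) (·-congˡ (·-congˡ V-0#)))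
      (solve 2 (λ x y → y :+ x :* con (+ 0) :+ x :* (x :* con (+ 0)) := y) ≈-refl X (one ⊕ ⊖ V x)))))
    (≈-trans (Norm-weave (one ⊕ ⊖ x) (const (+ 0)) (const (+ 0)))
      (solve 2 (λ q y → y :* y :* y :+ q :* (con (+ 0) :* con (+ 0) :* con (+ 0))
           :+ q :* q :* (con (+ 0) :* con (+ 0) :* con (+ 0)) :+ :- (con (+ 3) :* q :* y :* con (+ 0) :* con (+ 0))
         := y :* y :* y) ≈-refl X (one ⊕ ⊖ x)))

  -- Over the cube roots of unity ω, the product of 1 - ω q y is 1 - q³ y³, and here y is a series
  -- in q³.
  Norm-one⊖X·V : Norm (one ⊕ ⊖ (X · V x)) ≈ one ⊕ ⊖ (X · (x · x · x))
  Norm-one⊖X·V = ≈-trans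
    (Norm-cong (≈-sym (≈-trans (⊕-cong (⊕-cong V-one (·-congˡ (V-⊖ x))) (·-congˡ (·-congˡ V-0#)))
      (solve 3 (λ x y i → i :+ x :* (:- y) :+ x :* (x :* con (+ 0)) := i :+ :- (x :* y)) ≈-refl X (V x) one))))
    (≈-trans (Norm-weave one (⊖ x) (const (+ 0)))
      (≈-trans (⊕-congʳ (⊕-congʳ (⊕-congʳ (≈-trans (·-identityʳ _) (·-identityʳ one)))))
        (solve 3 (λ q x i → i :+ q :* (:- x :* :- x :* :- x)
           :+ q :* q :* (con (+ 0) :* con (+ 0) :* con (+ 0)) :+ :- (con (+ 3) :* q :* i :* (:- x) :* con (+ 0))
         := i :+ :- (q :* (x :* x :* x))) ≈-refl X x one)))

  Norm-one⊖X·X·V : Norm (one ⊕ ⊖ (X · (X · V x))) ≈ one ⊕ ⊖ (X · (X · (x · x · x)))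
  Norm-one⊖X·X·V = ≈-trans
    (Norm-cong (≈-sym (≈-trans (⊕-cong (⊕-cong V-one (·-congˡ V-0#)) (·-congˡ (·-congˡ (V-⊖ x))))
      (solve 3 (λ x y i → i :+ x :* con (+ 0) :+ x :* (x :* (:- y)) := i :+ :- (x :* (x :* y))) ≈-refl X (V x) one))))
    (≈-trans (Norm-weave one (const (+ 0)) (⊖ x))
      (≈-trans (⊕-congʳ (⊕-congʳ (⊕-congʳ (≈-trans (·-identityʳ _) (·-identityʳ one)))))
        (solve 3 (λ q x i → i :+ q :* (con (+ 0) :* con (+ 0) :* con (+ 0))
           :+ q :* q :* (:- x :* :- x :* :- x) :+ :- (con (+ 3) :* q :* i :* con (+ 0) :* (:- x))
         := i :+ :- (q :* (q :* (x :* x :* x)))) ≈-refl X x one)))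

partialE1-suc : ∀ N → partialE 1 (suc N) ≈ partialE 1 N · (one ⊕ ⊖ (X ↑ suc N))
partialE1-suc N = ≈-trans (partialE-suc 1 N)
  (·-congˡ (⊕-congˡ (⊖-cong (↑-congʳ X (ℕ.*-identityˡ (suc N))))))

V-X↑* : ∀ m → V (X ↑ m) ≈ X ↑ (m ℕ.* 3)
V-X↑* m = ≈-trans (V-X↑ m) (↑-congʳ X (ℕ.*-comm 3 m))

X↑-cubed : ∀ m → X ↑ m · X ↑ m · X ↑ m ≈ X ↑ (m ℕ.* 3)
X↑-cubed m = ≈-trans
  (solve 1 (λ x → x :* x :* x := x :^ 3) ≈-refl (X ↑ m)) (↑-assocʳ X m 3)

-- This is a finite form of the conjugate product of E₁, written in q instead of q³. A factor 1 - qᵏ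
-- with k prime to 3 is its own norm, whereas 1 - q³ᵏ has norm (1 - qᵏ)³. Multiplying by
-- `partialE 3 N` restores the factors with exponents divisible by 3.
Norm-partialE : ∀ N → Norm (partialE 1 (N ℕ.* 3)) · partialE 3 N ≈ partialE 1 (N ℕ.* 3) · partialE 1 N ↑ 3
Norm-partialE zero = ≈-trans (·-identityʳ (Norm one)) (begin
  Norm one                                 ≈⟨ norm₃-cong U0-one U1-one U2-one ⟩
  norm₃ one (const (+ 0)) (const (+ 0))    ≈⟨ solve 2 (λ q y → y :* y :* y :+ q :* (con (+ 0) :* con (+ 0) :* con (+ 0))
     :+ q :* q :* (con (+ 0) :* con (+ 0) :* con (+ 0)) :+ :- (con (+ 3) :* q :* y :* con (+ 0) :* con (+ 0))
     := y :* y :* y) ≈-refl X one ⟩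
  one · one · one                          ≈⟨ ·-congʳ (·-identityʳ one) ⟩
  one · one                                ≈⟨ ·-congˡ (one↑ 3) ⟨
  one · one ↑ 3                            ∎)
  where open SetoidReasoning setoid
Norm-partialE (suc N) = begin
  Norm (partialE 1 (3 ℕ.+ N ℕ.* 3)) · partialE 3 (suc N)
    ≈⟨ ·-cong (Norm-cong split) (≈-trans (partialE-suc 3 N) (·-congˡ (⊕-congˡ (⊖-cong (↑-congʳ X (ℕ.*-comm 3 (suc N))))))) ⟩
  Norm (Q · y₁ · y₂ · y₃) · (T · y₃)
    ≈⟨ ·-congʳ (≈-trans (Norm-· _ _) (·-cong (≈-trans (Norm-· _ _) (·-cong (Norm-· _ _) Ny₂)) Ny₃)) ⟩
  Norm Q · Norm y₁ · y₂ · (z · z · z) · (T · y₃)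
    ≈⟨ ·-congʳ (·-congʳ (·-congʳ (·-congˡ Ny₁))) ⟩
  Norm Q · y₁ · y₂ · (z · z · z) · (T · y₃)
    ≈⟨ solve 6 (λ n y₁ y₂ y₃ z t → n :* y₁ :* y₂ :* (z :* z :* z) :* (t :* y₃) :=
         n :* t :* (y₁ :* y₂ :* y₃ :* (z :* z :* z))) ≈-refl (Norm Q) y₁ y₂ y₃ z T ⟩
  Norm Q · T · (y₁ · y₂ · y₃ · (z · z · z))
    ≈⟨ ·-congʳ (Norm-partialE N) ⟩
  Q · R ↑ 3 · (y₁ · y₂ · y₃ · (z · z · z))
    ≈⟨ solve 6 (λ q y₁ y₂ y₃ z r → q :* r :^ 3 :* (y₁ :* y₂ :* y₃ :* (z :* z :* z)) :=
         q :* y₁ :* y₂ :* y₃ :* (r :* z) :^ 3) ≈-refl Q y₁ y₂ y₃ z R ⟩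
  Q · y₁ · y₂ · y₃ · (R · z) ↑ 3
    ≈⟨ ·-cong split (↑-congˡ 3 (partialE1-suc N)) ⟨
  partialE 1 (3 ℕ.+ N ℕ.* 3) · partialE 1 (suc N) ↑ 3 ∎
  where
  open SetoidReasoning setoid
  Q  = partialE 1 (N ℕ.* 3)
  R  = partialE 1 N
  T  = partialE 3 N
  y₁ = one ⊕ ⊖ (X ↑ (1 ℕ.+ N ℕ.* 3))
  y₂ = one ⊕ ⊖ (X ↑ (2 ℕ.+ N ℕ.* 3))
  y₃ = one ⊕ ⊖ (X ↑ (3 ℕ.+ N ℕ.* 3))
  z  = one ⊕ ⊖ (X ↑ suc N)
  split : partialE 1 (3 ℕ.+ N ℕ.* 3) ≈ Q · y₁ · y₂ · y₃
  split = ≈-trans (partialE1-suc (2 ℕ.+ N ℕ.* 3))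
    (·-congʳ (≈-trans (partialE1-suc (1 ℕ.+ N ℕ.* 3)) (·-congʳ (partialE1-suc (N ℕ.* 3)))))
  Ny₁ : Norm y₁ ≈ y₁
  Ny₁ = ≈-trans (Norm-cong (⊕-congˡ (⊖-cong (·-congˡ (≈-sym (V-X↑* N))))))
    (≈-trans (Norm-one⊖X·V (X ↑ N)) (⊕-congˡ (⊖-cong (·-congˡ (X↑-cubed N)))))
  Ny₂ : Norm y₂ ≈ y₂
  Ny₂ = ≈-trans (Norm-cong (⊕-congˡ (⊖-cong (·-congˡ (·-congˡ (≈-sym (V-X↑* N)))))))
    (≈-trans (Norm-one⊖X·X·V (X ↑ N)) (⊕-congˡ (⊖-cong (·-congˡ (·-congˡ (X↑-cubed N))))))
  Ny₃ : Norm y₃ ≈ z · z · z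
  Ny₃ = ≈-trans (Norm-cong (⊕-congˡ (⊖-cong (≈-sym (V-X↑* (suc N)))))) (Norm-one⊖V (X ↑ suc N))

Norm-E1 : Norm (E 1) · E 3 ≈ E 1 ↑ 4
Norm-E1 = ≈-from-upTo λ n → ≈[]-trans
  (·-upTo (Norm-upTo (E-upTo 0 (ℕ.n≤1+n _))) (E-upTo 2 (ℕ.n≤1+n n)))
  -- `suc n` blocks give 3n + 3 factors, which covers the degree 3n + 2 demanded by `Norm-upTo`.
  (≈[]-trans (upTo (Norm-partialE (suc n)))
    (≈[]-sym (·-upTo (E-upTo 0 (ℕ.≤-trans (ℕ.m≤m*n n 3) (ℕ.m≤n+m _ 3)))
      (·-upTo E≈ (·-upTo E≈ (·-upTo E≈ ≈[]-refl))))))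
  where
  E≈ : ∀ {n} → E 1 ≈[ n ] partialE 1 (suc n)
  E≈ {n} = E-upTo 0 (ℕ.n≤1+n n)

-- Jacobi's formula for the cube of E 1

-- theta n k is the coefficient of zᵏ in Π_{i=1}^{n} (1 - z qⁱ) Π_{i=0}^{n} (1 - qⁱ / z).  It is only
-- needed for k ≥ 0, because the coefficients of zᵏ and z⁻¹⁻ᵏ are opposite to each other.

prev : (ℕ → Series) → ℕ → Series
prev f zero    = ⊖ f zero
prev f (suc k) = f k

theta : ℕ → ℕ → Series
theta zero    zero    = one
theta zero    (suc k) = const (+ 0)
theta (suc n) k       = (one ⊕ x · x) · theta n k ⊕ ⊖ (x · (prev (theta n) k ⊕ theta n (suc k)))
  where x = X ↑ suc n

-- This is what the substitution z ↦ q z does to the product.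
theta-shift : ∀ n k →
  theta n k · (one ⊕ ⊖ (X ↑ suc n · X ↑ k)) ⊕ (X ↑ k ⊕ ⊖ (X ↑ suc n)) · prev (theta n) k ≈ const (+ 0)
theta-shift n zero = ≈-trans
  (⊕-congʳ (·-congˡ (⊕-congˡ (⊖-cong (·-identityʳ (X ↑ suc n))))))
  (solve 3 (λ a x i → a :* (i :+ :- x) :+ (i :+ :- x) :* :- a := con (+ 0)) ≈-refl (theta n 0) (X ↑ suc n) one)
theta-shift zero (suc zero) =
  solve 3 (λ x a y → con (+ 0) :* y :+ (x :+ :- x) :* a := con (+ 0)) ≈-refl (X ↑ 1) one (one ⊕ ⊖ (X ↑ 1 · X ↑ 1))
theta-shift zero (suc (suc k)) =
  solve 2 (λ y x → con (+ 0) :* y :+ x :* con (+ 0) := con (+ 0)) ≈-refl _ _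
theta-shift (suc n) (suc k) = begin
  ((one ⊕ x · x) · A₁ ⊕ ⊖ (x · (A₀ ⊕ A₂))) · (one ⊕ ⊖ (X · x · (X · y)))
    ⊕ (X · y ⊕ ⊖ (X · x)) · ((one ⊕ x · x) · A₀ ⊕ ⊖ (x · (A₋ ⊕ A₁)))
    -- The relations for `n` at k + 1, k + 2 and k are weighted by the coefficients 1 + q x², -x and
    -- -q x of (1 - q x z)(1 - x/z), the factor that both sides of the functional equation gain when
    -- n grows by one.
    ≈⟨ solve 7 (λ q x y a₋ a₀ a₁ a₂ →
         ((:1 :+ x :* x) :* a₁ :+ :- (x :* (a₀ :+ a₂))) :* (:1 :+ :- (q :* x :* (q :* y)))
           :+ (q :* y :+ :- (q :* x)) :* ((:1 :+ x :* x) :* a₀ :+ :- (x :* (a₋ :+ a₁)))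
         := (:1 :+ q :* x :* x) :* (a₁ :* (:1 :+ :- (x :* (q :* y))) :+ (q :* y :+ :- x) :* a₀)
           :+ :- (x :* (a₂ :* (:1 :+ :- (x :* (q :* (q :* y)))) :+ (q :* (q :* y) :+ :- x) :* a₁))
           :+ :- (x :* q :* (a₀ :* (:1 :+ :- (x :* y)) :+ (y :+ :- x) :* a₋)))
         ≈-refl X x y A₋ A₀ A₁ A₂ ⟩
  (one ⊕ X · x · x) · (A₁ · (one ⊕ ⊖ (x · (X · y))) ⊕ (X · y ⊕ ⊖ x) · A₀)
    ⊕ ⊖ (x · (A₂ · (one ⊕ ⊖ (x · (X · (X · y)))) ⊕ (X · (X · y) ⊕ ⊖ x) · A₁))
    ⊕ ⊖ (x · X · (A₀ · (one ⊕ ⊖ (x · y)) ⊕ (y ⊕ ⊖ x) · A₋))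
    ≈⟨ ⊕-cong (⊕-cong (·-congˡ (theta-shift n (suc k))) (⊖-cong (·-congˡ (theta-shift n (suc (suc k)))))) (⊖-cong (·-congˡ (theta-shift n k))) ⟩
  (one ⊕ X · x · x) · const (+ 0) ⊕ ⊖ (x · const (+ 0)) ⊕ ⊖ (x · X · const (+ 0))
    ≈⟨ solve 2 (λ q x → (:1 :+ q :* x :* x) :* con (+ 0) :+ :- (x :* con (+ 0)) :+ :- (x :* q :* con (+ 0))
         := con (+ 0)) ≈-refl X x ⟩
  const (+ 0) ∎
  where
  open SetoidReasoning setoid
  x  = X ↑ suc n
  y  = X ↑ k
  A₋ = prev (theta n) k
  A₀ = theta n k
  A₁ = theta n (suc k)
  A₂ = theta n (suc (suc k))

theta-support : ∀ {n k} → n ℕ.< k → theta n k ≈ const (+ 0)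
theta-support {zero}  {suc k} _         = ≈-refl
theta-support {suc n} {suc k} (s≤s n<k) = ≈-trans
  (⊕-cong (·-congˡ (theta-support (ℕ.m≤n⇒m≤1+n n<k)))
    (⊖-cong (·-congˡ (⊕-cong (theta-support n<k) (theta-support (ℕ.m≤n⇒m≤1+n (ℕ.m≤n⇒m≤1+n n<k)))))))
  (solve 2 (λ u x → u :* con (+ 0) :+ :- (x :* (con (+ 0) :+ con (+ 0))) := con (+ 0)) ≈-refl _ (X ↑ suc n))

sumS : ℕ → (ℕ → Series) → Series
sumS zero    f = f 0
sumS (suc n) f = sumS n f ⊕ f (suc n)

odd : ℕ → Series
odd zero    = one
odd (suc k) = odd k ⊕ const (+ 2)

-- The sum is the z-derivative of the product at z = 1.
theta-sum-suc : ∀ n K → let x = X ↑ suc n in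
  sumS K (λ k → odd k · theta (suc n) k) ≈
    (one ⊕ ⊖ x) · (one ⊕ ⊖ x) · sumS K (λ k → odd k · theta n k)
      ⊕ x · (odd (suc K) · theta n K ⊕ ⊖ (odd K · theta n (suc K)))
theta-sum-suc n zero = begin
  one · ((one ⊕ x · x) · A₀ ⊕ ⊖ (x · (⊖ A₀ ⊕ A₁)))
    ≈⟨ solve 3 (λ x a₀ a₁ → :1 :* ((:1 :+ x :* x) :* a₀ :+ :- (x :* (:- a₀ :+ a₁))) :=
         (:1 :+ :- x) :* (:1 :+ :- x) :* (:1 :* a₀)
           :+ x :* ((:1 :+ con (+ 2)) :* a₀ :+ :- (:1 :* a₁))) ≈-refl x A₀ A₁ ⟩
  (one ⊕ ⊖ x) · (one ⊕ ⊖ x) · (one · A₀) ⊕ x · ((one ⊕ const (+ 2)) · A₀ ⊕ ⊖ (one · A₁)) ∎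
  where
  open SetoidReasoning setoid
  x  = X ↑ suc n
  A₀ = theta n 0
  A₁ = theta n 1
theta-sum-suc n (suc K) = begin
  sumS K (λ k → odd k · theta (suc n) k) ⊕ (o ⊕ const (+ 2)) · ((one ⊕ x · x) · A₁ ⊕ ⊖ (x · (A₀ ⊕ A₂)))
    ≈⟨ ⊕-congʳ (theta-sum-suc n K) ⟩
  (one ⊕ ⊖ x) · (one ⊕ ⊖ x) · S ⊕ x · ((o ⊕ const (+ 2)) · A₀ ⊕ ⊖ (o · A₁))
    ⊕ (o ⊕ const (+ 2)) · ((one ⊕ x · x) · A₁ ⊕ ⊖ (x · (A₀ ⊕ A₂)))
    -- The weights 2k + 1 form an arithmetic progression, so the factor 1 + x² - x (z + 1/z) acts on
    -- the weighted sum as (1 - x)², up to a boundary term at the cut-off `K`.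
    ≈⟨ solve 6 (λ x s o a₀ a₁ a₂ →
         (:1 :+ :- x) :* (:1 :+ :- x) :* s :+ x :* ((o :+ con (+ 2)) :* a₀ :+ :- (o :* a₁))
           :+ (o :+ con (+ 2)) :* ((:1 :+ x :* x) :* a₁ :+ :- (x :* (a₀ :+ a₂)))
         := (:1 :+ :- x) :* (:1 :+ :- x) :* (s :+ (o :+ con (+ 2)) :* a₁)
           :+ x :* ((o :+ con (+ 2) :+ con (+ 2)) :* a₁ :+ :- ((o :+ con (+ 2)) :* a₂)))
         ≈-refl x S o A₀ A₁ A₂ ⟩
  (one ⊕ ⊖ x) · (one ⊕ ⊖ x) · (S ⊕ (o ⊕ const (+ 2)) · A₁)
    ⊕ x · ((o ⊕ const (+ 2) ⊕ const (+ 2)) · A₁ ⊕ ⊖ ((o ⊕ const (+ 2)) · A₂)) ∎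
  where
  open SetoidReasoning setoid
  x  = X ↑ suc n
  o  = odd K
  S  = sumS K (λ k → odd k · theta n k)
  A₀ = theta n K
  A₁ = theta n (suc K)
  A₂ = theta n (suc (suc K))

-- Once the range covers the support of the coefficients, the boundary term of `theta-sum-suc`
-- vanishes and each step only multiplies by (1 - qⁿ⁺¹)².
theta-sum : ∀ {n K} → n ℕ.≤ K → sumS K (λ k → odd k · theta n k) ≈ partialE 1 n · partialE 1 n
theta-sum {zero} {zero}  _ = ≈-refl
theta-sum {zero} {suc K} _ = ≈-trans (⊕-cong (theta-sum {zero} {K} z≤n) (·-zeroʳ (odd (suc K)))) (⊕-identityʳ _)
theta-sum {suc n} {K} n<K = begin
  sumS K (λ k → odd k · theta (suc n) k)
    ≈⟨ theta-sum-suc n K ⟩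
  y · y · sumS K (λ k → odd k · theta n k) ⊕ x · (odd (suc K) · theta n K ⊕ ⊖ (odd K · theta n (suc K)))
    ≈⟨ ⊕-cong (·-congˡ (theta-sum (ℕ.<⇒≤ n<K)))
         (·-congˡ (⊕-cong (·-congˡ (theta-support n<K)) (⊖-cong (·-congˡ (theta-support (ℕ.m≤n⇒m≤1+n n<K)))))) ⟩
  y · y · (R · R) ⊕ x · (odd (suc K) · const (+ 0) ⊕ ⊖ (odd K · const (+ 0)))
    ≈⟨ solve 5 (λ x y r o o′ → y :* y :* (r :* r) :+ x :* (o′ :* con (+ 0) :+ :- (o :* con (+ 0)))
         := r :* y :* (r :* y)) ≈-refl x y R (odd K) (odd (suc K)) ⟩
  R · y · (R · y)
    ≈⟨ ·-cong (partialE1-suc n) (partialE1-suc n) ⟨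
  partialE 1 (suc n) · partialE 1 (suc n) ∎
  where
  open SetoidReasoning setoid
  x = X ↑ suc n
  y = one ⊕ ⊖ x
  R = partialE 1 n

-- The constant coefficient in z is the Gaussian binomial coefficient of 2n + 1 over n, which tends
-- to 1/E₁. In the induction step, `theta-shift` at k = 1 eliminates `theta n 1`.
theta-0 : ∀ n → theta n 0 · partialE 1 n · partialE 1 (suc n) ≈ partialE 1 (suc (n ℕ.* 2))
theta-0 zero    = ≈-trans (·-congʳ (·-identityʳ one)) (·-identityˡ _)
theta-0 (suc n) = begin
  ((one ⊕ x · x) · A₀ ⊕ ⊖ (x · (⊖ A₀ ⊕ A₁))) · R′ · partialE 1 (suc (suc n))
    ≈⟨ ·-congˡ (partialE1-suc (suc n)) ⟩
  ((one ⊕ x · x) · A₀ ⊕ ⊖ (x · (⊖ A₀ ⊕ A₁))) · R′ · (R′ · (one ⊕ ⊖ (X · x)))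
    ≈⟨ solve 5 (λ q x r a₀ a₁ →
         ((:1 :+ x :* x) :* a₀ :+ :- (x :* (:- a₀ :+ a₁))) :* r :* (r :* (:1 :+ :- (q :* x)))
         := (:1 :+ x) :* (:1 :+ :- (q :* (x :* x))) :* (a₀ :* r :* r)
           :+ :- (x :* r :* r :* (a₁ :* (:1 :+ :- (x :* q)) :+ (q :+ :- x) :* a₀)))
         ≈-refl X x R′ A₀ A₁ ⟩
  (one ⊕ x) · (one ⊕ ⊖ (X · (x · x))) · (A₀ · R′ · R′)
    ⊕ ⊖ (x · R′ · R′ · (A₁ · (one ⊕ ⊖ (x · X)) ⊕ (X ⊕ ⊖ x) · A₀))
    ≈⟨ ⊕-cong (·-congˡ (·-congʳ (·-congˡ (partialE1-suc n))))
         (⊖-cong (·-congˡ (≈-trans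
           (⊕-cong (·-congˡ (⊕-congˡ (⊖-cong (·-congˡ (≈-sym (·-identityʳ X)))))) (·-congʳ (⊕-congʳ (≈-sym (·-identityʳ X)))))
           (theta-shift n 1)))) ⟩
  (one ⊕ x) · (one ⊕ ⊖ (X · (x · x))) · (A₀ · (R · (one ⊕ ⊖ x)) · R′) ⊕ ⊖ (x · R′ · R′ · const (+ 0))
    ≈⟨ solve 5 (λ q x r r′ a₀ →
         (:1 :+ x) :* (:1 :+ :- (q :* (x :* x))) :* (a₀ :* (r :* (:1 :+ :- x)) :* r′)
           :+ :- (x :* r′ :* r′ :* con (+ 0))
         := a₀ :* r :* r′ :* (:1 :+ :- (x :^ 2)) :* (:1 :+ :- (q :* x :^ 2)))
         ≈-refl X x R R′ A₀ ⟩
  A₀ · R · R′ · (one ⊕ ⊖ (x ↑ 2)) · (one ⊕ ⊖ (X · x ↑ 2))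
    ≈⟨ ·-cong (·-cong (theta-0 n) (⊕-congˡ (⊖-cong (↑-assocʳ X (suc n) 2))))
         (⊕-congˡ (⊖-cong (·-congˡ (↑-assocʳ X (suc n) 2)))) ⟩
  partialE 1 (suc (n ℕ.* 2)) · (one ⊕ ⊖ (X ↑ (2 ℕ.+ n ℕ.* 2))) · (one ⊕ ⊖ (X ↑ (3 ℕ.+ n ℕ.* 2)))
    ≈⟨ ≈-trans (partialE1-suc (2 ℕ.+ n ℕ.* 2)) (·-congʳ (partialE1-suc (1 ℕ.+ n ℕ.* 2))) ⟨
  partialE 1 (3 ℕ.+ n ℕ.* 2) ∎
  where
  open SetoidReasoning setoid
  x  = X ↑ suc n
  A₀ = theta n 0
  A₁ = theta n 1
  R  = partialE 1 n
  R′ = partialE 1 (suc n)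

E1-inverse : E 1 · inv (E 1) ≈ one
E1-inverse = inv-inverseʳ refl

theta-0-upTo : ∀ n → theta n 0 · E 1 ≈[ n ] one
theta-0-upTo n = ·-cancelˡ-upTo (theta n 0 · E 1) one E1-inverse (begin
  E 1 · (theta n 0 · E 1)                          ≈⟨ upTo (solve 2 (λ e a → e :* (a :* e) := a :* e :* e) ≈-refl (E 1) (theta n 0)) ⟩
  theta n 0 · E 1 · E 1                            ≈⟨ ·-upTo (·-upTo ≈[]-refl (E-upTo 0 ℕ.≤-refl)) (E-upTo 0 (ℕ.n≤1+n n)) ⟩
  theta n 0 · partialE 1 n · partialE 1 (suc n)    ≈⟨ upTo (theta-0 n) ⟩
  partialE 1 (suc (n ℕ.* 2))                       ≈⟨ E-upTo 0 (ℕ.≤-trans (ℕ.m≤m*n n 2) (ℕ.n≤1+n _)) ⟨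
  E 1                                              ≈⟨ upTo (·-identityʳ (E 1)) ⟨
  E 1 · one                                        ∎)
  where open SetoidReasoning (upToSetoid n)

-- sign k is (-1)ᵏ q^(k(k+1)/2).
sign : ℕ → Series
sign zero    = one
sign (suc k) = ⊖ (X ↑ suc k · sign k)

-- Up to degree n the power qⁿ⁺¹ is zero, and `theta-shift` degenerates to the two-term recursion
-- that also defines `sign`.
theta-upTo : ∀ n k → theta n k ≈[ n ] sign k · theta n 0
theta-upTo n zero    = upTo (≈-sym (·-identityˡ (theta n 0)))
theta-upTo n (suc k) = begin
  A₁
    ≈⟨ upTo (solve 2 (λ a b → a := a :+ b :+ :- b) ≈-refl A₁ (y · A₀)) ⟩
  A₁ ⊕ y · A₀ ⊕ ⊖ (y · A₀)
    ≈⟨ ⊕-upTo vanish (⊖-upTo (·-upTo ≈[]-refl (theta-upTo n k))) ⟩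
  const (+ 0) ⊕ ⊖ (y · (sign k · theta n 0))
    ≈⟨ upTo (solve 3 (λ y s t → con (+ 0) :+ :- (y :* (s :* t)) := :- (y :* s) :* t) ≈-refl y (sign k) (theta n 0)) ⟩
  sign (suc k) · theta n 0 ∎
  where
  open SetoidReasoning (upToSetoid n)
  x  = X ↑ suc n
  y  = X ↑ suc k
  A₀ = theta n k
  A₁ = theta n (suc k)
  x≈0 : x ≈[ n ] const (+ 0)
  x≈0 = X↑-upTo ℕ.≤-refl
  vanish : A₁ ⊕ y · A₀ ≈[ n ] const (+ 0)
  vanish = begin
    A₁ ⊕ y · A₀
      ≈⟨ upTo (⊕-congʳ (≈-sym (·-identityʳ A₁))) ⟩
    A₁ · one ⊕ y · A₀
      ≈⟨ upTo (solve 4 (λ i a b y → a :* i :+ y :* b := a :* (i :+ :- (con (+ 0) :* y)) :+ (y :+ :- con (+ 0)) :* b)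
           ≈-refl one A₁ A₀ y) ⟩
    A₁ · (one ⊕ ⊖ (const (+ 0) · y)) ⊕ (y ⊕ ⊖ const (+ 0)) · A₀
      ≈⟨ ⊕-upTo (·-upTo ≈[]-refl (⊕-upTo ≈[]-refl (⊖-upTo (·-upTo x≈0 ≈[]-refl))))
           (·-upTo (⊕-upTo ≈[]-refl (⊖-upTo x≈0)) ≈[]-refl) ⟨
    A₁ · (one ⊕ ⊖ (x · y)) ⊕ (y ⊕ ⊖ x) · A₀
      ≈⟨ upTo (theta-shift n (suc k)) ⟩
    const (+ 0) ∎

jacobiSum : ℕ → Series
jacobiSum K = sumS K (λ k → odd k · sign k)

sumS-theta-upTo : ∀ n K → sumS K (λ k → odd k · theta n k) ≈[ n ] jacobiSum K · theta n 0
sumS-theta-upTo n zero    = upTo (≈-trans (·-identityˡ (theta n 0))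
  (≈-sym (≈-trans (·-congʳ (·-identityˡ one)) (·-identityˡ (theta n 0)))))
sumS-theta-upTo n (suc K) = ≈[]-trans
  (⊕-upTo (sumS-theta-upTo n K) (·-upTo ≈[]-refl (theta-upTo n (suc K))))
  (upTo (solve 4 (λ j t o s → j :* t :+ o :* (s :* t) := (j :+ o :* s) :* t) ≈-refl
    (jacobiSum K) (theta n 0) (odd (suc K)) (sign (suc K))))

-- In the limit the derivative at z = 1 is E₁² by `theta-sum`, and it is also the Jacobi sum times
-- the constant coefficient 1/E₁.
jacobi : ∀ n → E 1 ↑ 3 ≈[ n ] jacobiSum n
jacobi n = begin
  E 1 ↑ 3                                        ≈⟨ upTo (≈-trans (·-congˡ (·-congˡ (·-identityʳ _))) (≈-sym (·-assoc _ _ _))) ⟩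
  E 1 · E 1 · E 1                                ≈⟨ ·-upTo (·-upTo (E-upTo 0 ℕ.≤-refl) (E-upTo 0 ℕ.≤-refl)) ≈[]-refl ⟩
  partialE 1 n · partialE 1 n · E 1              ≈⟨ ·-upTo (upTo (theta-sum {n} {n} ℕ.≤-refl)) ≈[]-refl ⟨
  sumS n (λ k → odd k · theta n k) · E 1         ≈⟨ ·-upTo (sumS-theta-upTo n n) ≈[]-refl ⟩
  jacobiSum n · theta n 0 · E 1                  ≈⟨ upTo (·-assoc _ _ _) ⟩
  jacobiSum n · (theta n 0 · E 1)                ≈⟨ ·-upTo ≈[]-refl (theta-0-upTo n) ⟩
  jacobiSum n · one                              ≈⟨ upTo (·-identityʳ _) ⟩
  jacobiSum n                                    ∎
  where open SetoidReasoning (upToSetoid n)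

-- The 3-dissection of the cube of E 1

-- This is (-1)ᵏ q^(k(3k+1)/2), so that its exponent is a third of the triangular number 3k(3k+1)/2.
signThird : ℕ → Series
signThird zero    = one
signThird (suc k) = ⊖ (X ↑ suc k · X ↑ suc k · V (sign k))

X↑·signThird : ∀ k → X ↑ k · signThird k ≈ V (sign k)
X↑·signThird zero    = ≈-trans (·-identityˡ one) (≈-sym V-one)
X↑·signThird (suc k) = begin
  x · ⊖ (x · x · V (sign k))    ≈⟨ solve 2 (λ x s → x :* :- (x :* x :* s) := :- (x :* x :* x :* s)) ≈-refl x (V (sign k)) ⟩
  ⊖ (x · x · x · V (sign k))    ≈⟨ ⊖-cong (·-congʳ (≈-trans (X↑-cubed (suc k)) (≈-sym (V-X↑* (suc k))))) ⟩
  ⊖ (V x · V (sign k))          ≈⟨ ≈-trans (V-⊖ _) (⊖-cong (V-· x (sign k))) ⟨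
  V (sign (suc k))              ∎
  where
  open SetoidReasoning setoid
  x = X ↑ suc k

mutual
  sign-0 : ∀ k → sign (k ℕ.* 3) ≈ V (signThird k)
  sign-0 zero    = ≈-sym V-one
  sign-0 (suc k) = begin
    ⊖ (X ↑ (3 ℕ.+ k ℕ.* 3) · sign (2 ℕ.+ k ℕ.* 3))
      ≈⟨ ⊖-cong (·-cong (≈-sym (V-X↑* (suc k))) (sign-2 k)) ⟩
    ⊖ (V x · V (x · V (sign k)))
      ≈⟨ ⊖-cong (≈-trans (V-cong (·-assoc x x _)) (V-· x _)) ⟨
    ⊖ V (x · x · V (sign k))
      ≈⟨ V-⊖ _ ⟨
    V (signThird (suc k)) ∎
    where
    open SetoidReasoning setoid
    x = X ↑ suc k

  -- Triangular numbers are never 2 modulo 3, and they are 1 only for indices 3k + 1, where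
  -- (3k+1)(3k+2)/2 = 1 + 9 k(k+1)/2. The factor 9 makes the middle section a copy of Jacobi's
  -- series in q⁹.
  sign-1 : ∀ k → sign (1 ℕ.+ k ℕ.* 3) ≈ ⊖ (X · V (V (sign k)))
  sign-1 k = ⊖-cong (begin
    X · X ↑ (k ℕ.* 3) · sign (k ℕ.* 3)       ≈⟨ ·-cong (·-congˡ (≈-sym (V-X↑* k))) (sign-0 k) ⟩
    X · V (X ↑ k) · V (signThird k)          ≈⟨ ·-assoc _ _ _ ⟩
    X · (V (X ↑ k) · V (signThird k))        ≈⟨ ·-congˡ (≈-trans (≈-sym (V-· _ _)) (V-cong (X↑·signThird k))) ⟩
    X · V (V (sign k))                       ∎)
    where open SetoidReasoning setoid

  sign-2 : ∀ k → sign (2 ℕ.+ k ℕ.* 3) ≈ V (X ↑ suc k · V (sign k))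
  sign-2 k = begin
    ⊖ (y · sign (1 ℕ.+ k ℕ.* 3))             ≈⟨ ⊖-cong (·-congˡ (sign-1 k)) ⟩
    ⊖ (y · ⊖ (X · V (V (sign k))))           ≈⟨ solve 3 (λ x y s → :- (y :* :- (x :* s)) := x :* y :* s) ≈-refl X y _ ⟩
    X ↑ (3 ℕ.+ k ℕ.* 3) · V (V (sign k))     ≈⟨ ·-congʳ (V-X↑* (suc k)) ⟨
    V (X ↑ suc k) · V (V (sign k))           ≈⟨ V-· _ _ ⟨
    V (X ↑ suc k · V (sign k))               ∎
    where
    open SetoidReasoning setoid
    y = X ↑ (2 ℕ.+ k ℕ.* 3)

V-odd : ∀ k → V (odd k) ≈ odd k
V-odd zero    = V-one
V-odd (suc k) = ≈-trans (V-⊕ _ _) (⊕-cong (V-odd k) (V-const (+ 2)))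

odd-1 : ∀ k → odd (1 ℕ.+ k ℕ.* 3) ≈ const (+ 3) · odd k
odd-1 zero    = solve 0 (:1 :+ con (+ 2) := con (+ 3) :* :1) ≈-refl
odd-1 (suc k) = ≈-trans (⊕-congʳ (⊕-congʳ (⊕-congʳ (odd-1 k))))
  (solve 1 (λ o → con (+ 3) :* o :+ con (+ 2) :+ con (+ 2) :+ con (+ 2) := con (+ 3) :* (o :+ con (+ 2))) ≈-refl (odd k))

-- Partial sums of the series P: of each block of three consecutive Jacobi terms, the outer two have
-- exponents divisible by 3 and are collected here.
jacobiThird : ℕ → Series
jacobiThird K = sumS K (λ k → odd (k ℕ.* 3) · signThird k ⊕ odd (2 ℕ.+ k ℕ.* 3) · (X ↑ suc k · V (sign k)))

private
  block : ∀ k → odd (k ℕ.* 3) · sign (k ℕ.* 3) ⊕ odd (1 ℕ.+ k ℕ.* 3) · sign (1 ℕ.+ k ℕ.* 3)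
      ⊕ odd (2 ℕ.+ k ℕ.* 3) · sign (2 ℕ.+ k ℕ.* 3)
    ≈ V (odd (k ℕ.* 3) · signThird k ⊕ odd (2 ℕ.+ k ℕ.* 3) · (X ↑ suc k · V (sign k)))
      ⊕ ⊖ (const (+ 3) · X · V (V (odd k · sign k)))
  block k = begin
    o₀ · sign (k ℕ.* 3) ⊕ odd (1 ℕ.+ k ℕ.* 3) · sign (1 ℕ.+ k ℕ.* 3) ⊕ o₂ · sign (2 ℕ.+ k ℕ.* 3)
      ≈⟨ ⊕-cong (⊕-cong (·-cong (≈-sym (V-odd (k ℕ.* 3))) (sign-0 k)) (·-cong (odd-1 k) (sign-1 k)))
           (·-cong (≈-sym (V-odd (2 ℕ.+ k ℕ.* 3))) (sign-2 k)) ⟩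
    V o₀ · V s₀ ⊕ const (+ 3) · odd k · ⊖ (X · V (V (sign k))) ⊕ V o₂ · V s₂
      ≈⟨ solve 5 (λ a o x s b → a :+ con (+ 3) :* o :* :- (x :* s) :+ b := a :+ b :+ :- (con (+ 3) :* x :* (o :* s)))
           ≈-refl (V o₀ · V s₀) (odd k) X (V (V (sign k))) (V o₂ · V s₂) ⟩
    V o₀ · V s₀ ⊕ V o₂ · V s₂ ⊕ ⊖ (const (+ 3) · X · (odd k · V (V (sign k))))
      ≈⟨ ⊕-cong (V-⊕-· o₀ s₀ o₂ s₂) (⊖-cong (·-congˡ (≈-trans (V-cong (V-· _ _)) (≈-trans (V-· _ _)
           (·-congʳ (≈-trans (V-cong (V-odd k)) (V-odd k))))))) ⟨
    V (o₀ · s₀ ⊕ o₂ · s₂) ⊕ ⊖ (const (+ 3) · X · V (V (odd k · sign k))) ∎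
    where
    open SetoidReasoning setoid
    o₀ = odd (k ℕ.* 3)
    o₂ = odd (2 ℕ.+ k ℕ.* 3)
    s₀ = signThird k
    s₂ = X ↑ suc k · V (sign k)

jacobiSum-dissection : ∀ K →
  jacobiSum (2 ℕ.+ K ℕ.* 3) ≈ V (jacobiThird K) ⊕ ⊖ (const (+ 3) · X · V (V (jacobiSum K)))
jacobiSum-dissection zero    = block 0
jacobiSum-dissection (suc K) = begin
  jacobiSum (2 ℕ.+ K ℕ.* 3) ⊕ b₀ ⊕ b₁ ⊕ b₂
    ≈⟨ solve 4 (λ j a b c → j :+ a :+ b :+ c := j :+ (a :+ b :+ c)) ≈-refl (jacobiSum (2 ℕ.+ K ℕ.* 3)) b₀ b₁ b₂ ⟩
  jacobiSum (2 ℕ.+ K ℕ.* 3) ⊕ (b₀ ⊕ b₁ ⊕ b₂)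
    ≈⟨ ⊕-cong (jacobiSum-dissection K) (block (suc K)) ⟩
  V (jacobiThird K) ⊕ ⊖ (const (+ 3) · X · V (V (jacobiSum K))) ⊕ (V t ⊕ ⊖ (const (+ 3) · X · V (V s)))
    ≈⟨ solve 5 (λ a b c d x → a :+ :- (con (+ 3) :* x :* b) :+ (c :+ :- (con (+ 3) :* x :* d))
         := a :+ c :+ :- (con (+ 3) :* x :* (b :+ d)))
         ≈-refl (V (jacobiThird K)) (V (V (jacobiSum K))) (V t) (V (V s)) X ⟩
  V (jacobiThird K) ⊕ V t ⊕ ⊖ (const (+ 3) · X · (V (V (jacobiSum K)) ⊕ V (V s)))
    ≈⟨ ⊕-cong (V-⊕ _ _) (⊖-cong (·-congˡ (≈-trans (V-cong (V-⊕ _ _)) (V-⊕ _ _)))) ⟨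
  V (jacobiThird (suc K)) ⊕ ⊖ (const (+ 3) · X · V (V (jacobiSum (suc K)))) ∎
  where
  open SetoidReasoning setoid
  term : ℕ → Series
  term k = odd k · sign k
  b₀ = term (3 ℕ.+ K ℕ.* 3)
  b₁ = term (4 ℕ.+ K ℕ.* 3)
  b₂ = term (5 ℕ.+ K ℕ.* 3)
  s  = term (suc K)
  t  = odd (suc K ℕ.* 3) · signThird (suc K) ⊕ odd (2 ℕ.+ suc K ℕ.* 3) · (X ↑ suc (suc K) · V (sign (suc K)))

E1³ : Series
E1³ = E 1 ↑ 3

private
  E1³-dissection : ∀ n → E1³ ≈[ 2 ℕ.+ n ℕ.* 3 ]
    weave (jacobiThird n) (⊖ (const (+ 3) · V (jacobiSum n))) (const (+ 0))
  E1³-dissection n = ≈[]-trans (jacobi (2 ℕ.+ n ℕ.* 3)) (upTo (≈-trans (jacobiSum-dissection n) (≈-sym (≈-trans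
    (⊕-cong (⊕-congˡ (·-congˡ (≈-trans (V-⊖ _) (⊖-cong (≈-trans (V-· _ _) (·-congʳ (V-const (+ 3))))))))
      (·-congˡ (·-congˡ (V-const (+ 0)))))
    (solve 3 (λ x a b → a :+ x :* :- (con (+ 3) :* b) :+ x :* (x :* con (+ 0)) := a :+ :- (con (+ 3) :* x :* b))
      ≈-refl X (V (jacobiThird n)) (V (V (jacobiSum n))))))))

U1-E1³ : U 1 E1³ ≈ ⊖ (const (+ 3) · V E1³)
U1-E1³ = ≈-from-upTo λ n → ≈[]-trans (U-upTo 1 (upTo-≤ (ℕ.n≤1+n _) (E1³-dissection n)))
  (≈[]-trans (upTo (U1-weave _ _ _)) (⊖-upTo (·-upTo ≈[]-refl (V-upTo (≈[]-sym (jacobi n))))))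

U2-E1³ : U 2 E1³ ≈ const (+ 0)
U2-E1³ = ≈-from-upTo λ n → ≈[]-trans (U-upTo 2 (E1³-dissection n)) (upTo (U2-weave _ _ _))

E1³-weave : E1³ ≈ weave (U 0 E1³) (⊖ (const (+ 3) · V E1³)) (const (+ 0))
E1³-weave = ≈-trans (weave-U E1³) (⊕-cong (⊕-congˡ (·-congˡ (V-cong U1-E1³))) (·-congˡ (·-congˡ (V-cong U2-E1³))))

-- Both sides are the norm of E₁³ times E₃³. One evaluation uses the dissection, whose last section
-- is zero and whose middle one contributes 27 = 3³; the other is the cube of `Norm-E1`.
Norm-E1³ : (U 0 E1³ ↑ 3 ⊕ ⊖ (const (+ 27) · X · V E1³ ↑ 3)) · V E1³ ≈ E1³ ↑ 4
Norm-E1³ = begin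
  (P ↑ 3 ⊕ ⊖ (const (+ 27) · X · a ↑ 3)) · a
    ≈⟨ ·-congʳ (solve 3 (λ p x a → p :^ 3 :+ :- (con (+ 27) :* x :* a :^ 3) :=
         p :* p :* p :+ x :* (:- (con (+ 3) :* a) :* :- (con (+ 3) :* a) :* :- (con (+ 3) :* a))
           :+ x :* x :* (con (+ 0) :* con (+ 0) :* con (+ 0)) :+ :- (con (+ 3) :* x :* p :* :- (con (+ 3) :* a) :* con (+ 0)))
         ≈-refl P X a) ⟩
  norm₃ P (⊖ (const (+ 3) · a)) (const (+ 0)) · a
    ≈⟨ ·-congʳ (norm₃-cong ≈-refl U1-E1³ U2-E1³) ⟨
  Norm E1³ · a
    ≈⟨ ·-cong (≈-trans (Norm-· _ _) (·-congˡ (≈-trans (Norm-· _ _) (·-congˡ (Norm-cong (·-identityʳ _))))))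
         (≈-trans (V-↑ (E 1) 3) (↑-congˡ 3 (V-E 0))) ⟩
  N · (N · N) · E 3 ↑ 3
    ≈⟨ solve 2 (λ n e → n :* (n :* n) :* e :^ 3 := (n :* e) :^ 3) ≈-refl N (E 3) ⟩
  (N · E 3) ↑ 3
    ≈⟨ ↑-congˡ 3 Norm-E1 ⟩
  (E 1 ↑ 4) ↑ 3
    ≈⟨ solve 1 (λ e → (e :^ 4) :^ 3 := (e :^ 3) :^ 4) ≈-refl (E 1) ⟩
  E1³ ↑ 4 ∎
  where
  open SetoidReasoning setoid
  P = U 0 E1³
  a = V E1³
  N = Norm (E 1)

-- The relation between t and Y

-- a = E₃³, b = E₉³, i = 1/E₁³, α = 1/E₃³, t = q E₃¹²/E₁¹², Y = q E₉³/E₁³.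

a b i α t Y : Series
a = V E1³
b = V a
i = inv (E 1) ↑ 3
α = V i
t = X · (a ↑ 4 · i ↑ 4)
Y = X · b · i

E1³·i : E1³ · i ≈ one
E1³·i = ↑-inverse 3 E1-inverse

V-inverse : ∀ {f g} → f · g ≈ one → V f · V g ≈ one
V-inverse fg≈1 = ≈-trans (≈-sym (V-· _ _)) (≈-trans (V-cong fg≈1) V-one)

a·α : a · α ≈ one
a·α = V-inverse E1³·i

b·Vα : b · V α ≈ one
b·Vα = V-inverse a·α

private
  -- By `Norm-E1³`, `M` is E₁¹²/E₃³, and `μ` is its reciprocal. In terms of `π` and `β` the
  -- dissection reads E₁³ = π - 3β.
  P μ M π β : Series
  P = U 0 E1³
  μ = a · i ↑ 4
  M = P ↑ 3 ⊕ ⊖ (const (+ 27) · X · a ↑ 3)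
  π = V P
  β = X · b

  M·μ : M · μ ≈ one
  M·μ = ≈-trans (≈-sym (·-assoc M a (i ↑ 4))) (≈-trans (·-congʳ Norm-E1³) (↑-inverse 4 E1³·i))

  VM : V M ≈ π ↑ 3 ⊕ ⊖ (const (+ 27) · β ↑ 3)
  VM = begin
    V M
      ≈⟨ ≈-trans (V-⊕ _ _) (⊕-cong (V-↑ P 3) (≈-trans (V-⊖ _)
           (⊖-cong (≈-trans (V-· _ _) (·-cong (≈-trans (V-· _ _) (·-cong (V-const (+ 27)) V-X)) (V-↑ a 3)))))) ⟩
    π ↑ 3 ⊕ ⊖ (const (+ 27) · (X · (X · X)) · b ↑ 3)
      ≈⟨ solve 3 (λ p x b → p :^ 3 :+ :- (con (+ 27) :* (x :* (x :* x)) :* b :^ 3)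
           := p :^ 3 :+ :- (con (+ 27) :* (x :* b) :^ 3)) ≈-refl π X b ⟩
    π ↑ 3 ⊕ ⊖ (const (+ 27) · β ↑ 3) ∎
    where open SetoidReasoning setoid

  E1³≈ : E1³ ≈ π ⊕ ⊖ (const (+ 3) · β)
  E1³≈ = begin
    E1³
      ≈⟨ E1³-weave ⟩
    π ⊕ X · V (⊖ (const (+ 3) · a)) ⊕ X · (X · V (const (+ 0)))
      ≈⟨ ⊕-cong (⊕-congˡ (·-congˡ (≈-trans (V-⊖ _) (⊖-cong (≈-trans (V-· _ _) (·-congʳ (V-const (+ 3))))))))
           (·-congˡ (·-congˡ (V-const (+ 0)))) ⟩
    π ⊕ X · ⊖ (const (+ 3) · b) ⊕ X · (X · const (+ 0))
      ≈⟨ solve 3 (λ p x b → p :+ x :* :- (con (+ 3) :* b) :+ x :* (x :* con (+ 0)) := p :+ :- (con (+ 3) :* (x :* b)))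
           ≈-refl π X b ⟩
    π ⊕ ⊖ (const (+ 3) · β) ∎
    where open SetoidReasoning setoid

  -- E₁³ = π - 3β divides π³ - 27β³ = `V M`, whose reciprocal `V μ` is a series in q³. The cofactor
  -- therefore displays 1/E₁³ with its sections.
  i≈ : i ≈ (π · π ⊕ const (+ 3) · π · β ⊕ const (+ 9) · β · β) · V μ
  i≈ = ·-cancelˡ i _ E1³·i (begin
    E1³ · i
      ≈⟨ E1³·i ⟩
    one
      ≈⟨ V-inverse M·μ ⟨
    V M · V μ
      ≈⟨ ·-congʳ VM ⟩
    (π ↑ 3 ⊕ ⊖ (const (+ 27) · β ↑ 3)) · V μ
      ≈⟨ solve 3 (λ p b u → (p :^ 3 :+ :- (con (+ 27) :* b :^ 3)) :* u :=
           (p :+ :- (con (+ 3) :* b)) :* ((p :* p :+ con (+ 3) :* p :* b :+ con (+ 9) :* b :* b) :* u))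
           ≈-refl π β (V μ) ⟩
    (π ⊕ ⊖ (const (+ 3) · β)) · ((π · π ⊕ const (+ 3) · π · β ⊕ const (+ 9) · β · β) · V μ)
      ≈⟨ ·-congʳ E1³≈ ⟨
    E1³ · ((π · π ⊕ const (+ 3) · π · β ⊕ const (+ 9) · β · β) · V μ) ∎)
    where open SetoidReasoning setoid

  t≈ : t ≈ X · (a ↑ 3 · μ)
  t≈ = solve 3 (λ x a i → x :* (a :^ 4 :* i :^ 4) := x :* (a :^ 3 :* (a :* i :^ 4))) ≈-refl X a i

  V-const· : ∀ k f → V (const k · f) ≈ const k · V f
  V-const· k f = ≈-trans (V-· _ _) (·-congʳ (V-const k))

  V-·₃ : ∀ f g h → V (f · g · h) ≈ V f · V g · V h
  V-·₃ f g h = ≈-trans (V-· _ _) (·-congʳ (V-· f g))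

  -- After multiplication by q b, the three monomials of the cofactor in `i≈` carry q, q² and q³, so
  -- each one yields a section.
  Y-weave : Y ≈ weave (const (+ 9) · t) (a · (P · P) · μ) (const (+ 3) · (P · (a · a) · μ))
  Y-weave = ≈-trans (·-congˡ i≈) (≈-trans
    (solve 4 (λ x b p u → x :* b :* ((p :* p :+ con (+ 3) :* p :* (x :* b) :+ con (+ 9) :* (x :* b) :* (x :* b)) :* u)
       := con (+ 9) :* (x :* (x :* x) :* (b :^ 3 :* u)) :+ x :* (b :* (p :* p) :* u)
          :+ x :* (x :* (con (+ 3) :* (p :* (b :* b) :* u)))) ≈-refl X b π (V μ))
    (≈-sym (⊕-cong (⊕-cong
      (≈-trans (V-const· (+ 9) t) (·-congˡ (≈-trans (V-cong t≈) (≈-trans (V-X· _) (·-congˡ (≈-trans (V-· _ _) (·-congʳ (V-↑ a 3))))))))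
      (·-congˡ (≈-trans (V-·₃ _ _ _) (·-congʳ (·-congˡ (V-· P P))))))
      (·-congˡ (·-congˡ (≈-trans (V-const· (+ 3) _) (·-congˡ (≈-trans (V-·₃ _ _ _) (·-congʳ (·-congˡ (V-· a a)))))))))))

U0-Y : U 0 Y ≈ const (+ 9) · t
U0-Y = ≈-trans (U-cong 0 Y-weave) (U0-weave _ _ _)

U0-Y² : U 0 (Y ↑ 2) ≈ const (+ 6) · t ⊕ const (+ 243) · t · t
U0-Y² = begin
  U 0 (Y ↑ 2)
    ≈⟨ U-cong 0 (≈-trans (·-congˡ (·-identityʳ Y)) (≈-trans (·-cong Y-weave Y-weave) (weave-· _ _ _ _ _ _))) ⟩
  U 0 (weave (y₀ · y₀ ⊕ X · (y₁ · y₂ ⊕ y₂ · y₁)) _ _)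
    ≈⟨ U0-weave _ _ _ ⟩
  y₀ · y₀ ⊕ X · (y₁ · y₂ ⊕ y₂ · y₁)
    -- The cross terms contain P³, which is replaced by M + 27 q a³; since M μ = 1, a polynomial in
    -- t remains, with 243 = 81 + 6 · 27.
    ≈⟨ solve 5 (λ t x a p u →
         con (+ 9) :* t :* (con (+ 9) :* t) :+ x :* (a :* (p :* p) :* u :* (con (+ 3) :* (p :* (a :* a) :* u))
           :+ con (+ 3) :* (p :* (a :* a) :* u) :* (a :* (p :* p) :* u))
         := con (+ 81) :* t :* t
           :+ con (+ 6) :* (x :* (a :^ 3 :* u)) :* ((p :^ 3 :+ :- (con (+ 27) :* x :* a :^ 3)) :* u
             :+ con (+ 27) :* (x :* (a :^ 3 :* u))))
         ≈-refl t X a P μ ⟩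
  const (+ 81) · t · t ⊕ const (+ 6) · (X · (a ↑ 3 · μ)) · (M · μ ⊕ const (+ 27) · (X · (a ↑ 3 · μ)))
    ≈⟨ ⊕-congˡ (·-cong (·-congˡ (≈-sym t≈)) (⊕-cong M·μ (·-congˡ (≈-sym t≈)))) ⟩
  const (+ 81) · t · t ⊕ const (+ 6) · t · (one ⊕ const (+ 27) · t)
    ≈⟨ solve 1 (λ t → con (+ 81) :* t :* t :+ con (+ 6) :* t :* (:1 :+ con (+ 27) :* t)
         := con (+ 6) :* t :+ con (+ 243) :* t :* t) ≈-refl t ⟩
  const (+ 6) · t ⊕ const (+ 243) · t · t ∎
  where
  open SetoidReasoning setoid
  y₀ = const (+ 9) · t
  y₁ = a · (P · P) · μ
  y₂ = const (+ 3) · (P · (a · a) · μ)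

-- With π i = 1 + 3 Y and β i = Y, the bracket is (1 + 3 Y)³ - 27 Y³ = `V M` · i³. Multiplying by V
-- t = β³ · `V μ` leaves (β i)³.
Y³-relation : Y ↑ 3 ≈ V t · (one ⊕ const (+ 9) · Y ⊕ const (+ 27) · (Y · Y))
Y³-relation = ≈-sym (begin
  V t · (one ⊕ const (+ 9) · Y ⊕ const (+ 27) · (Y · Y))
    ≈⟨ ·-congˡ (solve 1 (λ y → :1 :+ con (+ 9) :* y :+ con (+ 27) :* (y :* y) :=
         (:1 :+ con (+ 3) :* y) :^ 3 :+ :- (con (+ 27) :* y :^ 3)) ≈-refl Y) ⟩
  V t · ((one ⊕ const (+ 3) · Y) ↑ 3 ⊕ ⊖ (const (+ 27) · Y ↑ 3))
    ≈⟨ ·-congˡ (⊕-congʳ (↑-congˡ 3 (≈-sym π·i))) ⟩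
  V t · ((π · i) ↑ 3 ⊕ ⊖ (const (+ 27) · Y ↑ 3))
    ≈⟨ ·-congʳ (≈-trans (V-cong t≈) (≈-trans (V-X· _) (·-congˡ (≈-trans (V-· _ _) (·-congʳ (V-↑ a 3)))))) ⟩
  X · (X · X) · (b ↑ 3 · V μ) · ((π · i) ↑ 3 ⊕ ⊖ (const (+ 27) · Y ↑ 3))
    ≈⟨ solve 5 (λ x b p i u → x :* (x :* x) :* (b :^ 3 :* u) :* ((p :* i) :^ 3 :+ :- (con (+ 27) :* (x :* b :* i) :^ 3))
         := (p :^ 3 :+ :- (con (+ 27) :* (x :* b) :^ 3)) :* u :* (x :* b :* i) :^ 3) ≈-refl X b π i (V μ) ⟩
  (π ↑ 3 ⊕ ⊖ (const (+ 27) · β ↑ 3)) · V μ · Y ↑ 3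
    ≈⟨ ·-congʳ (≈-trans (·-congʳ (≈-sym VM)) (V-inverse M·μ)) ⟩
  one · Y ↑ 3
    ≈⟨ ·-identityˡ _ ⟩
  Y ↑ 3 ∎)
  where
  open SetoidReasoning setoid
  π·i : π · i ≈ one ⊕ const (+ 3) · Y
  π·i = begin
    π · i
      ≈⟨ solve 4 (λ p x b i → p :* i := (p :+ :- (con (+ 3) :* (x :* b))) :* i :+ con (+ 3) :* (x :* b :* i)) ≈-refl π X b i ⟩
    (π ⊕ ⊖ (const (+ 3) · β)) · i ⊕ const (+ 3) · Y
      ≈⟨ ⊕-congʳ (≈-trans (·-congʳ (≈-sym E1³≈)) E1³·i) ⟩
    one ⊕ const (+ 3) · Y ∎

Vt·t : V t · t ≈ Y ↑ 4
Vt·t = begin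
  V t · t
    ≈⟨ ·-congʳ (≈-trans (V-X· _) (·-congˡ (≈-trans (V-· _ _) (·-cong (V-↑ a 4) (V-↑ i 4))))) ⟩
  X · (X · X) · (b ↑ 4 · α ↑ 4) · (X · (a ↑ 4 · i ↑ 4))
    ≈⟨ solve 5 (λ x a b c i → x :* (x :* x) :* (b :^ 4 :* c :^ 4) :* (x :* (a :^ 4 :* i :^ 4))
         := (a :* c) :^ 4 :* (x :* b :* i) :^ 4) ≈-refl X a b α i ⟩
  (a · α) ↑ 4 · Y ↑ 4
    ≈⟨ ·-congʳ (≈-trans (↑-congˡ 4 a·α) (one↑ 4)) ⟩
  one · Y ↑ 4
    ≈⟨ ·-identityˡ _ ⟩
  Y ↑ 4 ∎
  where open SetoidReasoning setoid

X²·i² : X · (X · i ↑ 2) ≈ V (α ↑ 2) · Y ↑ 2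
X²·i² = ≈-sym (begin
  V (α ↑ 2) · Y ↑ 2                ≈⟨ ·-congʳ (V-↑ α 2) ⟩
  V α ↑ 2 · (X · b · i) ↑ 2        ≈⟨ solve 4 (λ c x b i → c :^ 2 :* (x :* b :* i) :^ 2 := (b :* c) :^ 2 :* (x :* (x :* i :^ 2)))
                                        ≈-refl (V α) X b i ⟩
  (b · V α) ↑ 2 · (X · (X · i ↑ 2)) ≈⟨ ·-congʳ (≈-trans (↑-congˡ 2 b·Vα) (one↑ 2)) ⟩
  one · (X · (X · i ↑ 2))          ≈⟨ ·-identityˡ _ ⟩
  X · (X · i ↑ 2)                  ∎)
  where open SetoidReasoning setoid

-- t has no inverse among the power series, but it is q times a unit; cancellation takes the place
-- of division by tˡ.
t-cancel : ∀ {f g} → t · f ≈ t · g → f ≈ g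
t-cancel {f} {g} p = ·-cancelˡ f g (↑-inverse 4 unit) (X·-cancel (≈-trans (≈-sym (assoc f)) (≈-trans p (assoc g))))
  where
  unit : (a · i) · (α · E1³) ≈ one
  unit = ≈-trans (solve 4 (λ a i c e → a :* i :* (c :* e) := (a :* c) :* (e :* i)) ≈-refl a i α E1³)
    (≈-trans (·-cong a·α E1³·i) (·-identityˡ one))
  assoc : ∀ h → t · h ≈ X · ((a · i) ↑ 4 · h)
  assoc h = solve 4 (λ x a i h → x :* (a :^ 4 :* i :^ 4) :* h := x :* ((a :* i) :^ 4 :* h)) ≈-refl X a i h

t↑-cancel : ∀ l {f g} → t ↑ l · f ≈ t ↑ l · g → f ≈ g
t↑-cancel zero    p = ≈-trans (≈-sym (·-identityˡ _)) (≈-trans p (·-identityˡ _))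
t↑-cancel (suc l) p = t↑-cancel l (t-cancel (≈-trans (≈-sym (·-assoc _ _ _)) (≈-trans p (·-assoc _ _ _))))

-- Power series in t

t↑≈ : ∀ l → t ↑ l ≈ X ↑ l · (a ↑ 4 · i ↑ 4) ↑ l
t↑≈ l = ↑-distrib-· X _ l

-- This is the limit of the partial sums if g l vanishes to order l.
Σ∞ : (ℕ → Series) → Series
Σ∞ g n = sumℤ n (λ l → g l n)

X↑·-low : ∀ l f {n} → n ℕ.< l → (X ↑ l · f) n ≡ + 0
X↑·-low (suc l) f {n} (s≤s n≤l) = trans (at≤ (X↑·-upTo l f) n n≤l) (const-0 n)

Σ∞-cong : ∀ {g h} → (∀ l → g l ≈ h l) → Σ∞ g ≈ Σ∞ h
Σ∞-cong p = ext λ n → sumℤ-cong n (λ l → at (p l) n)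

opaque
  unfolding _⊕_

  ·-Σ∞ : ∀ f g → (∀ l {n} → n ℕ.< l → g l n ≡ + 0) → f · Σ∞ g ≈ Σ∞ (λ l → f · g l)
  ·-Σ∞ f g low = ext λ n → begin
    sumℤ n (λ k → f k ℤ.* sumℤ (n ∸ k) (λ l → g l (n ∸ k)))
      ≡⟨ sumℤ-cong n (λ k → trans
           (cong (λ x → f k ℤ.* x) (sym (sumℤ-extend (λ l → g l (n ∸ k)) (ℕ.m∸n≤m n k) (λ l → low l))))
           (sym (sumℤ-*ˡ n (f k) (λ l → g l (n ∸ k))))) ⟩
    sumℤ n (λ k → sumℤ n (λ l → f k ℤ.* g l (n ∸ k)))
      ≡⟨ sumℤ-swap n n _ ⟩
    sumℤ n (λ l → sumℤ n (λ k → f k ℤ.* g l (n ∸ k))) ∎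
    where open ≡-Reasoning

·-low : ∀ f g l → (∀ {n} → n ℕ.< l → g n ≡ + 0) → ∀ {n} → n ℕ.< l → (f · g) n ≡ + 0
·-low f g (suc l) low {n} (s≤s n≤l) = trans
  (at≤ (·-upTo {l} {f} {f} {g} {const (+ 0)} ≈[]-refl
    (ext≤ λ k k≤l → trans (low (s≤s k≤l)) (sym (const-0 k)))) n n≤l)
  (trans (at (·-zeroʳ f) n) (const-0 n))

t↑-low : ∀ l {n} → n ℕ.< l → (t ↑ l) n ≡ + 0
t↑-low l {n} n<l = trans (at (t↑≈ l) n) (X↑·-low l _ n<l)

W : (ℕ → ℤ) → Series
W c = Σ∞ (λ l → const (c l) · t ↑ l)

W-low : ∀ (c : ℕ → ℤ) l {n} → n ℕ.< l → (const (c l) · t ↑ l) n ≡ + 0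
W-low c l = ·-low (const (c l)) (t ↑ l) l (t↑-low l)

W-cong : ∀ {c d : ℕ → ℤ} → (∀ l → c l ≡ d l) → W c ≈ W d
W-cong p = Σ∞-cong λ l → ·-congʳ (ext λ n → cong (λ x → const x n) (p l))

W-+ : ∀ c d → W (λ l → c l ℤ.+ d l) ≈ W c ⊕ W d
W-+ c d = ext λ n → trans
  (sumℤ-cong n (λ l → trans
    (at (≈-trans (·-congʳ (const-+ (c l) (d l))) (·-distribʳ (t ↑ l) (const (c l)) (const (d l)))) n)
    (⊕-at (const (c l) · t ↑ l) (const (d l) · t ↑ l) n)))
  (trans (sumℤ-+ n _ _) (sym (⊕-at (W c) (W d) n)))

W-* : ∀ k c → W (λ l → k ℤ.* c l) ≈ const k · W c
W-* k c = ext λ n → trans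
  (sumℤ-cong n (λ l → trans (at (≈-trans (·-congʳ (const-* k (c l))) (·-assoc (const k) (const (c l)) (t ↑ l))) n)
    (const-· k (const (c l) · t ↑ l) n)))
  (trans (sumℤ-*ˡ n k _) (sym (const-· k (W c) n)))

W-suc : ∀ c → W c ≈ const (c 0) ⊕ t · W (λ l → c (suc l))
W-suc c = ext λ n → begin
  sumℤ n (λ l → (const (c l) · t ↑ l) n)
    ≡⟨ sumℤ-extend (λ l → (const (c l) · t ↑ l) n) (ℕ.n≤1+n n) (λ l → W-low c l) ⟨
  sumℤ (suc n) (λ l → (const (c l) · t ↑ l) n)
    ≡⟨ sumℤ-suc n (λ l → (const (c l) · t ↑ l) n) ⟩
  (const (c 0) · one) n ℤ.+ sumℤ n (λ l → (const (c (suc l)) · (t · t ↑ l)) n)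
    ≡⟨ cong₂ ℤ._+_ (at (·-identityʳ (const (c 0))) n) (sumℤ-cong n (λ l → at
         (solve 3 (λ c t s → c :* (t :* s) := t :* (c :* s)) ≈-refl (const (c (suc l))) t (t ↑ l)) n)) ⟩
  const (c 0) n ℤ.+ sumℤ n (λ l → (t · (const (c (suc l)) · t ↑ l)) n)
    ≡⟨ cong (λ x → const (c 0) n ℤ.+ x) (at (·-Σ∞ t _ (W-low (λ l → c (suc l)))) n) ⟨
  const (c 0) n ℤ.+ (t · W (λ l → c (suc l))) n
    ≡⟨ ⊕-at (const (c 0)) (t · W (λ l → c (suc l))) n ⟨
  (const (c 0) ⊕ t · W (λ l → c (suc l))) n ∎
  where open ≡-Reasoning

W-shift : ∀ l c → (∀ j → j ℕ.< l → c j ≡ + 0) → W c ≈ t ↑ l · W (λ k → c (l ℕ.+ k))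
W-shift zero    c h = ≈-sym (·-identityˡ _)
W-shift (suc l) c h = begin
  W c                                         ≈⟨ W-suc c ⟩
  const (c 0) ⊕ t · W (λ k → c (suc k))       ≡⟨ cong (λ x → const x ⊕ t · W (λ k → c (suc k))) (h 0 (s≤s z≤n)) ⟩
  const (+ 0) ⊕ t · W (λ k → c (suc k))       ≈⟨ ⊕-identityˡ _ ⟩
  t · W (λ k → c (suc k))                     ≈⟨ ·-congˡ (W-shift l (λ k → c (suc k)) (λ j j<l → h (suc j) (s≤s j<l))) ⟩
  t · (t ↑ l · W (λ k → c (suc l ℕ.+ k)))     ≈⟨ ·-assoc _ _ _ ⟨
  t ↑ suc l · W (λ k → c (suc l ℕ.+ k))       ∎
  where open SetoidReasoning setoid

-- The matrix m and the powers of Y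

row : ℕ → ℕ → ℤ
row i j = + m i j

row-0 : ∀ i → row i 0 ≡ + 0
row-0 zero    = refl
row-0 (suc i) = refl

W-row : ∀ i → W (row i) ≈ t · W (λ j → row i (suc j))
W-row i = ≈-trans (W-shift 1 (row i) (λ { zero _ → row-0 i ; (suc _) (s≤s ()) })) (·-congʳ (·-identityʳ t))

-- The recursion for m as an identity of generating functions in t; the first column, which it does
-- not govern, stays as a constant. For n < 2 the truncated subtraction lands on row 0, which is
-- zero, in accordance with m(i,j) = 0 for i ≤ 0.
W-row-suc : ∀ n → W (row (suc n)) ≈
  t · (const (row (suc n) 1)
    ⊕ (const (+ 27) · W (row n) ⊕ const (+ 9) · W (row (n ∸ 1)) ⊕ W (row (n ∸ 2))))
W-row-suc n = ≈-trans (W-row (suc n)) (·-congˡ (≈-trans (W-suc _) (⊕-congˡ (begin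
  t · W (λ j → row (suc n) (suc (suc j)))
    ≈⟨ ·-congˡ (W-cong split) ⟩
  t · W (λ j → + 27 ℤ.* r n j ℤ.+ + 9 ℤ.* r (n ∸ 1) j ℤ.+ r (n ∸ 2) j)
    ≈⟨ ·-congˡ (≈-trans (W-+ (λ j → + 27 ℤ.* r n j ℤ.+ + 9 ℤ.* r (n ∸ 1) j) (r (n ∸ 2)))
         (⊕-congʳ (≈-trans (W-+ (λ j → + 27 ℤ.* r n j) (λ j → + 9 ℤ.* r (n ∸ 1) j))
           (⊕-cong (W-* (+ 27) (r n)) (W-* (+ 9) (r (n ∸ 1))))))) ⟩
  t · (const (+ 27) · W (r n) ⊕ const (+ 9) · W (r (n ∸ 1)) ⊕ W (r (n ∸ 2)))
    ≈⟨ solve 4 (λ t a b c → t :* (con (+ 27) :* a :+ con (+ 9) :* b :+ c) :=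
         con (+ 27) :* (t :* a) :+ con (+ 9) :* (t :* b) :+ t :* c) ≈-refl t (W (r n)) (W (r (n ∸ 1))) (W (r (n ∸ 2))) ⟩
  const (+ 27) · (t · W (r n)) ⊕ const (+ 9) · (t · W (r (n ∸ 1))) ⊕ t · W (r (n ∸ 2))
    ≈⟨ ⊕-cong (⊕-cong (·-congˡ (W-row n)) (·-congˡ (W-row (n ∸ 1)))) (W-row (n ∸ 2)) ⟨
  const (+ 27) · W (row n) ⊕ const (+ 9) · W (row (n ∸ 1)) ⊕ W (row (n ∸ 2)) ∎))))
  where
  open SetoidReasoning setoid
  r : ℕ → ℕ → ℤ
  r i j = row i (suc j)
  split : ∀ j → row (suc n) (suc (suc j)) ≡ + 27 ℤ.* r n j ℤ.+ + 9 ℤ.* r (n ∸ 1) j ℤ.+ r (n ∸ 2) j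
  split j = trans (ℤ.pos-+ (27 ℕ.* m n (suc j) ℕ.+ 9 ℕ.* m (n ∸ 1) (suc j)) (m (n ∸ 2) (suc j)))
    (cong (ℤ._+ r (n ∸ 2) j) (trans (ℤ.pos-+ (27 ℕ.* m n (suc j)) (9 ℕ.* m (n ∸ 1) (suc j)))
      (cong₂ ℤ._+_ (ℤ.pos-* 27 (m n (suc j))) (ℤ.pos-* 9 (m (n ∸ 1) (suc j))))))

W-row-0 : W (row 0) ≈ const (+ 0)
W-row-0 = ext λ n → trans (sumℤ-0 n (λ l → trans (at (·-zeroˡ (t ↑ l)) n) (const-0 n))) (sym (const-0 n))

W-row-1 : W (row 1) ≈ const (+ 9) · t
W-row-1 = ≈-trans (W-row-suc 0)
  (≈-trans (·-congˡ (⊕-congˡ (⊕-cong (⊕-cong (·-congˡ W-row-0) (·-congˡ W-row-0)) W-row-0)))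
    (solve 1 (λ t → t :* (con (+ 9) :+ (con (+ 27) :* con (+ 0) :+ con (+ 9) :* con (+ 0) :+ con (+ 0)))
      := con (+ 9) :* t) ≈-refl t))

W-row-2 : W (row 2) ≈ const (+ 6) · t ⊕ const (+ 243) · t · t
W-row-2 = ≈-trans (W-row-suc 1)
  (≈-trans (·-congˡ (⊕-congˡ (⊕-cong (⊕-cong (·-congˡ W-row-1) (·-congˡ W-row-0)) W-row-0)))
    (solve 1 (λ t → t :* (con (+ 6) :+ (con (+ 27) :* (con (+ 9) :* t) :+ con (+ 9) :* con (+ 0) :+ con (+ 0)))
      := con (+ 6) :* t :+ con (+ 243) :* t :* t) ≈-refl t))

U0-Y↑-step : ∀ n → U 0 (Y ↑ (3 ℕ.+ n)) ≈
  t · (U 0 (Y ↑ n) ⊕ const (+ 9) · U 0 (Y ↑ (1 ℕ.+ n)) ⊕ const (+ 27) · U 0 (Y ↑ (2 ℕ.+ n)))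
U0-Y↑-step n = begin
  U 0 (Y ↑ (3 ℕ.+ n))
    ≈⟨ U-cong 0 (≈-trans (↑-homo-· Y 3 n) (≈-trans (·-congʳ Y³-relation) (≈-trans (·-assoc _ _ _) (·-congˡ
         (solve 2 (λ y z → (:1 :+ con (+ 9) :* y :+ con (+ 27) :* (y :* y)) :* z :=
           z :+ con (+ 9) :* (y :* z) :+ con (+ 27) :* (y :* (y :* z))) ≈-refl Y (Y ↑ n)))))) ⟩
  U 0 (V t · (Y ↑ n ⊕ const (+ 9) · Y ↑ (1 ℕ.+ n) ⊕ const (+ 27) · Y ↑ (2 ℕ.+ n)))
    ≈⟨ U0-V· t _ ⟩
  t · U 0 (Y ↑ n ⊕ const (+ 9) · Y ↑ (1 ℕ.+ n) ⊕ const (+ 27) · Y ↑ (2 ℕ.+ n))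
    ≈⟨ ·-congˡ (≈-trans (U-⊕ 0 _ _) (⊕-cong (≈-trans (U-⊕ 0 _ _) (⊕-congˡ (U0-const· (+ 9) _))) (U0-const· (+ 27) _))) ⟩
  t · (U 0 (Y ↑ n) ⊕ const (+ 9) · U 0 (Y ↑ (1 ℕ.+ n)) ⊕ const (+ 27) · U 0 (Y ↑ (2 ℕ.+ n))) ∎
  where
  open SetoidReasoning setoid
  U0-const· : ∀ k f → U 0 (const k · f) ≈ const k · U 0 f
  U0-const· k f = ≈-trans (U-cong 0 (·-congʳ (≈-sym (V-const k)))) (U0-V· (const k) f)

private
  -- The recurrence has order three, hence three consecutive exponents. They start at 1 because row
  -- 0 is zero whereas U(Y⁰) = 1; at exponent 3 this 1 is supplied by the entry m(3,1) = 1.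
  U0-Y↑-thrice : ∀ n → U 0 (Y ↑ (1 ℕ.+ n)) ≈ W (row (1 ℕ.+ n))
    × U 0 (Y ↑ (2 ℕ.+ n)) ≈ W (row (2 ℕ.+ n)) × U 0 (Y ↑ (3 ℕ.+ n)) ≈ W (row (3 ℕ.+ n))
  U0-Y↑-thrice zero = y₁ , y₂ , y₃
    where
    y₁ : U 0 (Y ↑ 1) ≈ W (row 1)
    y₁ = ≈-trans (U-cong 0 (·-identityʳ Y)) (≈-trans U0-Y (≈-sym W-row-1))
    y₂ : U 0 (Y ↑ 2) ≈ W (row 2)
    y₂ = ≈-trans U0-Y² (≈-sym W-row-2)
    y₃ : U 0 (Y ↑ 3) ≈ W (row 3)
    y₃ = ≈-trans (U0-Y↑-step 0) (≈-trans (·-congˡ (⊕-cong (⊕-cong U0-one (·-congˡ y₁)) (·-congˡ y₂)))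
      (≈-sym (≈-trans (W-row-suc 2) (≈-trans (·-congˡ (⊕-congˡ (⊕-congˡ W-row-0)))
        (solve 3 (λ t u v → t :* (con (+ 1) :+ (con (+ 27) :* v :+ con (+ 9) :* u :+ con (+ 0)))
          := t :* (:1 :+ con (+ 9) :* u :+ con (+ 27) :* v)) ≈-refl t (W (row 1)) (W (row 2)))))))
  U0-Y↑-thrice (suc n) with U0-Y↑-thrice n
  ... | p₁ , p₂ , p₃ = p₂ , p₃ , ≈-trans (U0-Y↑-step (suc n))
    (≈-trans (·-congˡ (⊕-cong (⊕-cong p₁ (·-congˡ p₂)) (·-congˡ p₃)))
      (≈-sym (≈-trans (W-row-suc (3 ℕ.+ n))
        (solve 4 (λ t u v w → t :* (con (+ 0) :+ (con (+ 27) :* w :+ con (+ 9) :* v :+ u))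
          := t :* (u :+ con (+ 9) :* v :+ con (+ 27) :* w)) ≈-refl t
          (W (row (1 ℕ.+ n))) (W (row (2 ℕ.+ n))) (W (row (3 ℕ.+ n)))))))

U0-Y↑ : ∀ n → U 0 (Y ↑ suc n) ≈ W (row (suc n))
U0-Y↑ n = proj₁ (U0-Y↑-thrice n)

-- This makes row 4l + r divisible by tˡ and bounds the sums that define c.
m-vanish : ∀ n j → 3 ℕ.* j ℕ.< n → m n j ≡ 0
m-vanish (suc n) zero _ = refl
m-vanish (suc (suc (suc (suc n)))) (suc zero) _ = refl
m-vanish (suc zero) (suc zero) (s≤s ())
m-vanish (suc (suc zero)) (suc zero) (s≤s (s≤s ()))
m-vanish (suc (suc (suc zero))) (suc zero) (s≤s (s≤s (s≤s ())))
m-vanish (suc n) (suc (suc j)) (s≤s h) = cong₂ ℕ._+_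
  (cong₂ ℕ._+_ (cong (27 ℕ.*_) (m-vanish n (suc j) (ℕ.≤-trans (s≤s (ℕ.m≤n+m _ 2)) n≥)))
               (cong (9 ℕ.*_) (m-vanish (n ∸ 1) (suc j) (ℕ.≤-trans (s≤s (ℕ.m≤n+m _ 1)) (ℕ.∸-monoˡ-≤ 1 n≥)))))
  (m-vanish (n ∸ 2) (suc j) (ℕ.∸-monoˡ-≤ 2 n≥))
  where
  n≥ : 3 ℕ.+ 3 ℕ.* suc j ℕ.≤ n
  n≥ = subst (ℕ._≤ n) (ℕ.*-suc 3 (suc j)) h

private
  row-vanish : ∀ r l j → j ℕ.< suc l → row (4 ℕ.* suc l ℕ.+ r) j ≡ + 0
  row-vanish r l j (s≤s j≤l) = cong +_ (m-vanish _ j (begin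
    suc (3 ℕ.* j)         ≤⟨ s≤s (ℕ.*-mono-≤ (ℕ.n≤1+n 3) j≤l) ⟩
    suc (4 ℕ.* l)         ≤⟨ s≤s (ℕ.m≤n+m (4 ℕ.* l) 3) ⟩
    4 ℕ.+ 4 ℕ.* l         ≡⟨ ℕ.*-suc 4 l ⟨
    4 ℕ.* suc l           ≤⟨ ℕ.m≤m+n (4 ℕ.* suc l) r ⟩
    4 ℕ.* suc l ℕ.+ r     ∎))
    where open ℕ.≤-Reasoning

-- The cases r = 0 and r = 2 are the two needed. The factor tˡ⁺¹ enters `U 0` as its image under
-- `V`, turns the argument into a pure power of Y, and is cancelled from the resulting row, whose
-- early entries vanish.
U0-Y↑·t↑ : ∀ r l → U 0 (Y ↑ r · t ↑ suc l) ≈ W (λ k → row (4 ℕ.* suc l ℕ.+ r) (suc l ℕ.+ k))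
U0-Y↑·t↑ r l = t↑-cancel (suc l) (begin
  t ↑ suc l · U 0 (Y ↑ r · t ↑ suc l)
    ≈⟨ U0-V· _ _ ⟨
  U 0 (V (t ↑ suc l) · (Y ↑ r · t ↑ suc l))
    ≈⟨ U-cong 0 (≈-trans (·-congʳ (V-↑ t (suc l)))
         (solve 3 (λ v y t → v :* (y :* t) := v :* t :* y) ≈-refl (V t ↑ suc l) (Y ↑ r) (t ↑ suc l))) ⟩
  U 0 (V t ↑ suc l · t ↑ suc l · Y ↑ r)
    ≈⟨ U-cong 0 (·-congʳ (≈-trans (≈-sym (↑-distrib-· (V t) t (suc l)))
         (≈-trans (↑-congˡ (suc l) Vt·t) (↑-assocʳ Y 4 (suc l))))) ⟩
  U 0 (Y ↑ (4 ℕ.* suc l) · Y ↑ r)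
    ≈⟨ U-cong 0 (≈-sym (↑-homo-· Y (4 ℕ.* suc l) r)) ⟩
  U 0 (Y ↑ (4 ℕ.* suc l ℕ.+ r))
    ≈⟨ U0-Y↑ _ ⟩
  W (row (4 ℕ.* suc l ℕ.+ r))
    ≈⟨ W-shift (suc l) (row (4 ℕ.* suc l ℕ.+ r)) (row-vanish r l) ⟩
  t ↑ suc l · W (λ k → row (4 ℕ.* suc l ℕ.+ r) (suc l ℕ.+ k)) ∎)
  where open SetoidReasoning setoid

-- The recursion for c

·-W-at : ∀ f c n → (f · W c) n ≡ sumℤ n (λ l → c l ℤ.* (f · t ↑ l) n)
·-W-at f c n = trans (at (·-Σ∞ f _ (W-low c)) n) (sumℤ-cong n λ l → trans
  (at (solve 3 (λ f k s → f :* (k :* s) := k :* (f :* s)) ≈-refl f (const (c l)) (t ↑ l)) n)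
  (const-· (c l) (f · t ↑ l) n))

-- `U 0` may be applied term by term because the coefficient of q³ⁿ involves only the powers tˡ with
-- l ≤ 3n; the two finite sums are then interchanged.
U0-·W : ∀ f (M : ℕ → ℕ → ℤ) (c c′ : ℕ → ℤ) →
  (∀ l → U 0 (f · t ↑ suc l) ≈ W (M (suc l))) →
  (∀ l k → 3 * k ℕ.< l → M l k ≡ + 0) →
  c 0 ≡ + 0 →
  (∀ k → c′ k ≡ sumℤ (3 * k) (λ l → c l ℤ.* M l k)) →
  U 0 (f · W c) ≈ W c′
U0-·W f M c c′ U0-f·t M-vanish c₀≡0 c′-def = ext λ n → begin
  U 0 (f · W c) n
    ≡⟨ U-at 0 (f · W c) n ⟩
  (f · W c) (n * 3)
    ≡⟨ ·-W-at f c (n * 3) ⟩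
  sumℤ (n * 3) (λ l → c l ℤ.* (f · t ↑ l) (n * 3))
    ≡⟨ sumℤ-cong (n * 3) (λ l → term n l) ⟩
  sumℤ (n * 3) (λ l → sumℤ n (λ k → c l ℤ.* M l k ℤ.* (t ↑ k) n))
    ≡⟨ sumℤ-swap (n * 3) n _ ⟩
  sumℤ n (λ k → sumℤ (n * 3) (λ l → c l ℤ.* M l k ℤ.* (t ↑ k) n))
    ≡⟨ sumℤ-cong-≤ n (λ k k≤n → column n k k≤n) ⟩
  W c′ n ∎
  where
  open ≡-Reasoning
  term : ∀ n l → c l ℤ.* (f · t ↑ l) (n * 3) ≡ sumℤ n (λ k → c l ℤ.* M l k ℤ.* (t ↑ k) n)
  term n zero = trans (cong (ℤ._* (f · t ↑ 0) (n * 3)) c₀≡0)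
    (sym (sumℤ-0 n (λ k → cong (λ x → x ℤ.* M 0 k ℤ.* (t ↑ k) n) c₀≡0)))
  term n (suc l) = begin
    c (suc l) ℤ.* (f · t ↑ suc l) (n * 3)
      ≡⟨ cong (λ x → c (suc l) ℤ.* x) (trans (sym (U-at 0 (f · t ↑ suc l) n)) (at (U0-f·t l) n)) ⟩
    c (suc l) ℤ.* W (M (suc l)) n
      ≡⟨ sumℤ-*ˡ n (c (suc l)) _ ⟨
    sumℤ n (λ k → c (suc l) ℤ.* (const (M (suc l) k) · t ↑ k) n)
      ≡⟨ sumℤ-cong n (λ k → trans (cong (λ x → c (suc l) ℤ.* x) (const-· (M (suc l) k) (t ↑ k) n))
           (sym (ℤ.*-assoc (c (suc l)) (M (suc l) k) ((t ↑ k) n)))) ⟩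
    sumℤ n (λ k → c (suc l) ℤ.* M (suc l) k ℤ.* (t ↑ k) n) ∎
  column : ∀ n k → k ≤ n → sumℤ (n * 3) (λ l → c l ℤ.* M l k ℤ.* (t ↑ k) n) ≡ (const (c′ k) · t ↑ k) n
  column n k k≤n = begin
    sumℤ (n * 3) (λ l → c l ℤ.* M l k ℤ.* T)
      ≡⟨ sumℤ-cong (n * 3) (λ l → ℤ.*-comm (c l ℤ.* M l k) T) ⟩
    sumℤ (n * 3) (λ l → T ℤ.* (c l ℤ.* M l k))
      ≡⟨ sumℤ-*ˡ (n * 3) T (λ l → c l ℤ.* M l k) ⟩
    T ℤ.* sumℤ (n * 3) (λ l → c l ℤ.* M l k)
      -- The sum defining `c′ k` stops at 3k, while the coefficient runs up to 3n; the entries in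
      -- between are zero.
      ≡⟨ cong (λ x → T ℤ.* x) (sumℤ-extend (λ l → c l ℤ.* M l k)
           (subst (3 * k ℕ.≤_) (ℕ.*-comm 3 n) (ℕ.*-monoʳ-≤ 3 k≤n))
           (λ l 3k<l → trans (cong (λ x → c l ℤ.* x) (M-vanish l k 3k<l)) (ℤ.*-zeroʳ (c l)))) ⟩
    T ℤ.* sumℤ (3 * k) (λ l → c l ℤ.* M l k)
      ≡⟨ trans (cong (λ x → T ℤ.* x) (sym (c′-def k))) (ℤ.*-comm T (c′ k)) ⟩
    c′ k ℤ.* T
      ≡⟨ const-· (c′ k) (t ↑ k) n ⟨
    (const (c′ k) · t ↑ k) n ∎
    where T = (t ↑ k) n

coeffs : ℕ → ℕ → ℤ
coeffs j k = + c j k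

sumℕ-cast : ∀ n f → + sumℕ n f ≡ sumℤ n (λ i → + f i)
sumℕ-cast zero    f = refl
sumℕ-cast (suc n) f = trans (ℤ.pos-+ (sumℕ n f) (f (suc n))) (cong (ℤ._+ + f (suc n)) (sumℕ-cast n f))

-- The exponent of Y in front of tˡ, and equally the offset between m(4l, ·) and m(4l+2, ·).
shift : Bool → ℕ
shift odd? = if odd? then 0 else 2

coeffs-suc : ∀ j k → coeffs (2 + j) k ≡
  sumℤ (3 * k) (λ l → coeffs (1 + j) l ℤ.* row (4 * l + shift (isOdd (1 + j))) (l + k))
coeffs-suc j zero    = refl
coeffs-suc j (suc k) = trans (sumℕ-cast (3 * suc k) _)
  (sumℤ-cong (3 * suc k) λ l → trans (ℤ.pos-* (c (suc j) l) _)
    (cong (λ x → coeffs (suc j) l ℤ.* row x (l + suc k)) (index (isOdd (1 + j)) l)))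
  where
  index : ∀ odd? l → (if odd? then 4 * l else 4 * l + 2) ≡ 4 * l + shift odd?
  index true  l = sym (ℕ.+-identityʳ (4 * l))
  index false l = refl

U0-W : ∀ j → let r = shift (isOdd (1 + j)) in
  U 0 (Y ↑ r · W (coeffs (1 + j))) ≈ W (coeffs (2 + j))
U0-W j = U0-·W (Y ↑ r) (λ l k → row (4 * l + r) (l + k)) (coeffs (1 + j)) (coeffs (2 + j))
  (U0-Y↑·t↑ r) vanish refl (coeffs-suc j)
  where
  r = shift (isOdd (1 + j))
  vanish : ∀ l k → 3 * k ℕ.< l → row (4 * l + r) (l + k) ≡ + 0
  vanish l k 3k<l = cong +_ (m-vanish (4 * l + r) (l + k) (begin-strict
    3 * (l + k)       ≡⟨ ℕ.*-distribˡ-+ 3 l k ⟩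
    3 * l + 3 * k     <⟨ ℕ.+-monoʳ-< (3 * l) 3k<l ⟩
    3 * l + l         ≡⟨ ℕ.+-comm (3 * l) l ⟩
    4 * l             ≤⟨ ℕ.m≤m+n (4 * l) r ⟩
    4 * l + r         ∎))
    where open ℕ.≤-Reasoning

isOdd-odd : ∀ j → isOdd (1 + j * 2) ≡ true
isOdd-odd j = cong (ℕ._≡ᵇ 1) ([m+kn]%n≡m%n 1 j 2)

isOdd-even : ∀ j → isOdd (2 + j * 2) ≡ false
isOdd-even j = cong (ℕ._≡ᵇ 1) ([m+kn]%n≡m%n 2 j 2)

U0-W-odd : ∀ j → U 0 (W (coeffs (1 + j * 2))) ≈ W (coeffs (2 + j * 2))
U0-W-odd j = ≈-trans (U-cong 0 (≈-sym (≈-trans (·-congʳ (↑-congʳ Y (cong shift (isOdd-odd j)))) (·-identityˡ _))))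
  (U0-W (j * 2))

U0-W-even : ∀ j → U 0 (Y ↑ 2 · W (coeffs (2 + j * 2))) ≈ W (coeffs (3 + j * 2))
U0-W-even j = ≈-trans (U-cong 0 (·-congʳ (↑-congʳ Y (sym (cong shift (isOdd-even j))))))
  (U0-W (1 + j * 2))

-- oddT j and evenT j are q times the left-hand sides of the two formulas, with j shifted by one.

mutual
  oddT : ℕ → Series
  oddT zero    = U 0 (X · p93)
  oddT (suc j) = U 0 (X · (X · evenT j))

  evenT : ℕ → Series
  evenT j = U 0 (oddT j)

a≈ : a ≈ E 3 ↑ 3
a≈ = ≈-trans (V-↑ (E 1) 3) (↑-congˡ 3 (V-E 0))

b≈ : b ≈ E 9 ↑ 3
b≈ = ≈-trans (V-cong a≈) (≈-trans (V-↑ (E 3) 3) (↑-congˡ 3 (V-E 2)))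

p93≈ : p93 ≈ i · V α
p93≈ = inv-unique (cong₂ ℤ._*_ (pow-0 (E 1) 3 refl) (pow-0 (E 9) 3 refl)) (begin
  pow (E 1) 3 ⊛ pow (E 9) 3 · (i · V α)
    ≈⟨ ·-congʳ (≈-trans (⊛≈· _ _) (·-cong (pow≈↑ (E 1) 3) (≈-trans (pow≈↑ (E 9) 3) (≈-sym b≈)))) ⟩
  E1³ · b · (i · V α)
    ≈⟨ solve 4 (λ e b i c → e :* b :* (i :* c) := e :* i :* (b :* c)) ≈-refl E1³ b i (V α) ⟩
  E1³ · i · (b · V α)
    ≈⟨ ·-cong E1³·i b·Vα ⟩
  one · one
    ≈⟨ ·-identityˡ one ⟩
  one ∎)
  where open SetoidReasoning setoid

mutual
  oddT≈ : ∀ j → oddT j ≈ α ↑ 2 · W (coeffs (1 + j * 2))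
  oddT≈ zero = begin
    U 0 (X · p93)
      ≈⟨ U-cong 0 (·-congˡ p93≈) ⟩
    U 0 (X · (i · V α))
      -- Inserting E₉³ · E₉⁻³ completes q E₁⁻³ to Y and leaves E₉⁻⁶, which passes through `U 0` as
      -- E₃⁻⁶.
      ≈⟨ U-cong 0 (≈-trans (·-congˡ (≈-trans (≈-sym (·-identityˡ _)) (·-congʳ (≈-sym b·Vα))))
           (≈-trans (solve 4 (λ x b i c → x :* (b :* c :* (i :* c)) := c :^ 2 :* (x :* b :* i)) ≈-refl X b i (V α))
             (·-congʳ (≈-sym (V-↑ α 2))))) ⟩
    U 0 (V (α ↑ 2) · Y)
      ≈⟨ ≈-trans (U0-V· (α ↑ 2) Y) (·-congˡ (≈-trans (U-cong 0 (≈-sym (·-identityʳ Y))) (U0-Y↑ 0))) ⟩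
    α ↑ 2 · W (row 1)
      -- The initial row of c is the first row of m, which is U(Y) = 9 t.
      ≈⟨ ·-congˡ (W-cong λ { zero → refl ; (suc zero) → refl ; (suc (suc k)) → refl }) ⟩
    α ↑ 2 · W (coeffs 1) ∎
    where open SetoidReasoning setoid
  oddT≈ (suc j) = begin
    U 0 (X · (X · evenT j))
      ≈⟨ U-cong 0 (·-congˡ (·-congˡ (evenT≈ j))) ⟩
    U 0 (X · (X · (i ↑ 2 · w)))
      ≈⟨ U-cong 0 (≈-trans (solve 3 (λ x c w → x :* (x :* (c :* w)) := x :* (x :* c) :* w) ≈-refl X (i ↑ 2) w)
           (≈-trans (·-congʳ X²·i²) (·-assoc _ _ _))) ⟩
    U 0 (V (α ↑ 2) · (Y ↑ 2 · w))
      ≈⟨ ≈-trans (U0-V· _ _) (·-congˡ (U0-W-even j)) ⟩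
    α ↑ 2 · W (coeffs (3 + j * 2)) ∎
    where
    open SetoidReasoning setoid
    w = W (coeffs (2 + j * 2))

  evenT≈ : ∀ j → evenT j ≈ i ↑ 2 · W (coeffs (2 + j * 2))
  evenT≈ j = begin
    U 0 (oddT j)                                  ≈⟨ U-cong 0 (≈-trans (oddT≈ j) (·-congʳ (≈-sym (V-↑ i 2)))) ⟩
    U 0 (V (i ↑ 2) · W (coeffs (1 + j * 2)))      ≈⟨ U0-V· _ _ ⟩
    i ↑ 2 · U 0 (W (coeffs (1 + j * 2)))          ≈⟨ ·-congˡ (U0-W-odd j) ⟩
    i ↑ 2 · W (coeffs (2 + j * 2))                ∎
    where open SetoidReasoning setoid

-- The arithmetic progressions on the left-hand sides

open ℕSolver using ()
  renaming (solve to solveℕ; con to conℕ; _:*_ to _:*ℕ_; _:+_ to _:+ℕ_; _:=_ to _:=ℕ_)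

-- Since 9A + 5 = 4 · 2A + (A + 5), the quotient by 4 grows by exactly 2A. With A an odd power of 3,
-- this is the change of offset from the first formula to the second.
quarter-step : ∀ A → (3 * (3 * A) + 5) / 4 ≡ A * 2 + (A + 5) / 4
quarter-step A = begin
  (3 * (3 * A) + 5) / 4
    ≡⟨ cong (_/ 4) (solveℕ 1 (λ A → conℕ 3 :*ℕ (conℕ 3 :*ℕ A) :+ℕ conℕ 5 :=ℕ A :*ℕ conℕ 2 :*ℕ conℕ 4 :+ℕ (A :+ℕ conℕ 5)) refl A) ⟩
  (A * 2 * 4 + (A + 5)) / 4
    ≡⟨ +-distrib-/-∣ˡ (A + 5) (n∣m*n (A * 2)) ⟩
  A * 2 * 4 / 4 + (A + 5) / 4
    ≡⟨ cong (_+ (A + 5) / 4) (m*n/n≡m (A * 2) 4) ⟩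
  A * 2 + (A + 5) / 4 ∎
  where
  open ≡-Reasoning

mutual
  oddT-at : ∀ j n → oddT j (suc n) ≡ p93 (3 ^ (1 + j * 2) * n + (3 ^ (1 + j * 2) + 5) / 4)
  oddT-at zero n = begin
    U 0 (X · p93) (suc n)     ≡⟨ U-at 0 (X · p93) (suc n) ⟩
    (X · p93) (3 + n * 3)     ≡⟨ X·-suc p93 (2 + n * 3) ⟩
    p93 (2 + n * 3)           ≡⟨ cong p93 (trans (ℕ.+-comm 2 (n * 3)) (cong (_+ 2) (ℕ.*-comm n 3))) ⟩
    p93 (3 * n + 2)           ∎
    where open ≡-Reasoning
  oddT-at (suc j) n = begin
    -- `evenT j` carries one factor q of its own. The two added here turn 3n + 3 into 3n + 1, which
    -- is index 3n of its progression, so the offset stays the same.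
    U 0 (X · (X · evenT j)) (suc n)    ≡⟨ U-at 0 (X · (X · evenT j)) (suc n) ⟩
    (X · (X · evenT j)) (3 + n * 3)    ≡⟨ trans (X·-suc (X · evenT j) (2 + n * 3)) (X·-suc (evenT j) (1 + n * 3)) ⟩
    evenT j (1 + n * 3)                ≡⟨ evenT-at j (n * 3) ⟩
    p93 (A * (n * 3) + (3 * A + 5) / 4)
      ≡⟨ cong (λ x → p93 (x + (3 * A + 5) / 4))
           (trans (cong (A *_) (ℕ.*-comm n 3)) (trans (sym (ℕ.*-assoc A 3 n)) (cong (_* n) (ℕ.*-comm A 3)))) ⟩
    p93 (3 * A * n + (3 * A + 5) / 4)  ∎
    where
    open ≡-Reasoning
    A = 3 ^ (2 + j * 2)

  evenT-at : ∀ j n → evenT j (suc n) ≡ p93 (3 ^ (2 + j * 2) * n + (3 ^ (3 + j * 2) + 5) / 4)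
  evenT-at j n = begin
    U 0 (oddT j) (suc n)                          ≡⟨ U-at 0 (oddT j) (suc n) ⟩
    oddT j (3 + n * 3)                            ≡⟨ oddT-at j (2 + n * 3) ⟩
    -- Index 3n + 2 of the progression with difference A: the part 2A goes into the offset.
    p93 (A * (2 + n * 3) + (A + 5) / 4)           ≡⟨ cong p93 (solveℕ 3 (λ A n d →
                                                       A :*ℕ (conℕ 2 :+ℕ n :*ℕ conℕ 3) :+ℕ d :=ℕ conℕ 3 :*ℕ A :*ℕ n :+ℕ (A :*ℕ conℕ 2 :+ℕ d))
                                                       refl A n ((A + 5) / 4)) ⟩
    p93 (3 * A * n + (A * 2 + (A + 5) / 4))       ≡⟨ cong (λ x → p93 (3 * A * n + x)) (sym (quarter-step A)) ⟩
    p93 (3 * A * n + (3 * (3 * A) + 5) / 4)       ∎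
    where
    open ≡-Reasoning
    A = 3 ^ (1 + j * 2)

-- The quotients on the right-hand sides

X↑·-at : ∀ l f n → l ≤ n → (X ↑ l · f) n ≡ f (n ∸ l)
X↑·-at zero    f n       _         = at (·-identityˡ f) n
X↑·-at (suc l) f (suc n) (s≤s l≤n) = trans (at (·-assoc X (X ↑ l) f) (suc n))
  (trans (X·-suc (X ↑ l · f) n) (X↑·-at l f n l≤n))

·-W-shiftedSum : ∀ f j F → c j 0 ≡ 0 → (∀ l → f · t ↑ suc l ≈ X ↑ suc l · F (suc l)) →
  ∀ n → (f · W (coeffs j)) (suc n) ≡ shiftedSum (c j) F n
·-W-shiftedSum f j F c₀≡0 f·t n = begin
  (f · W (coeffs j)) (suc n)
    ≡⟨ ·-W-at f (coeffs j) (suc n) ⟩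
  sumℤ (suc n) (λ l → coeffs j l ℤ.* (f · t ↑ l) (suc n))
    ≡⟨ sumℤ-suc n _ ⟩
  coeffs j 0 ℤ.* (f · one) (suc n) ℤ.+ sumℤ n (λ l → coeffs j (suc l) ℤ.* (f · t ↑ suc l) (suc n))
    -- Series in t start at l = 0, whereas the sums of the theorem start at l = 1; the default value
    -- c(j,0) = 0 removes the extra term.
    ≡⟨ cong (λ x → + x ℤ.* (f · one) (suc n) ℤ.+ sumℤ n (λ l → coeffs j (suc l) ℤ.* (f · t ↑ suc l) (suc n))) c₀≡0 ⟩
  + 0 ℤ.+ sumℤ n (λ l → coeffs j (suc l) ℤ.* (f · t ↑ suc l) (suc n))
    ≡⟨ ℤ.+-identityˡ _ ⟩
  sumℤ n (λ l → coeffs j (suc l) ℤ.* (f · t ↑ suc l) (suc n))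
    ≡⟨ sumℤ-cong-≤ n (λ l l≤n → cong (λ x → coeffs j (suc l) ℤ.* x)
         (trans (at (f·t l) (suc n)) (X↑·-at (suc l) (F (suc l)) (suc n) (s≤s l≤n)))) ⟩
  shiftedSum (c j) F n ∎
  where open ≡-Reasoning

private
  κ δ : Series
  κ = inv (E 1)
  δ = V κ

  E3·δ : E 3 · δ ≈ one
  E3·δ = ≈-trans (·-congʳ (≈-sym (V-E 0))) (V-inverse E1-inverse)

  t↑-E : ∀ l → t ↑ l ≈ X ↑ l · (E 3 ↑ (12 * l) · κ ↑ (12 * l))
  t↑-E l = ≈-trans (t↑≈ l) (·-congˡ (≈-trans (↑-distrib-· _ _ l) (·-cong
    (≈-trans (↑-congˡ l (≈-trans (↑-congˡ 4 a≈) (↑-assocʳ (E 3) 3 4))) (↑-assocʳ (E 3) 12 l))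
    (≈-trans (↑-congˡ l (↑-assocʳ κ 3 4)) (↑-assocʳ κ 12 l)))))

  pow-quotient : ∀ k l → pow (E 3) k ⊛ inv (pow (E 1) l) ≈ E 3 ↑ k · κ ↑ l
  pow-quotient k l = ≈-trans (⊛≈· _ _) (·-cong (pow≈↑ (E 3) k)
    (inv-unique (pow-0 (E 1) l refl) (≈-trans (·-congʳ (pow≈↑ (E 1) l)) (↑-inverse l E1-inverse))))

α²·t↑ : ∀ l → α ↑ 2 · t ↑ suc l ≈ X ↑ suc l · F-odd (suc l)
α²·t↑ l = begin
  α ↑ 2 · t ↑ suc l
    ≈⟨ ·-cong (↑-congˡ 2 (V-↑ κ 3)) (t↑-E (suc l)) ⟩
  (δ ↑ 3) ↑ 2 · (x · (E 3 ↑ k · κ ↑ k))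
    -- Six factors E₃ are split off to cancel E₃⁻⁶. As l + 1 is positive, the exponent is at least
    -- 12 and the truncated subtraction in `F-odd` is a true one.
    ≈⟨ ·-congˡ (·-congˡ (·-congʳ (≈-trans (↑-congʳ (E 3) (sym (ℕ.m+[n∸m]≡n 6≤k))) (↑-homo-· (E 3) 6 (k ∸ 6))))) ⟩
  (δ ↑ 3) ↑ 2 · (x · (E 3 ↑ 6 · E 3 ↑ (k ∸ 6) · κ ↑ k))
    ≈⟨ solve 5 (λ d x e f k → (d :^ 3) :^ 2 :* (x :* (e :^ 6 :* f :* k)) := (e :* d) :^ 6 :* (x :* (f :* k)))
         ≈-refl δ x (E 3) (E 3 ↑ (k ∸ 6)) (κ ↑ k) ⟩
  (E 3 · δ) ↑ 6 · (x · (E 3 ↑ (k ∸ 6) · κ ↑ k))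
    ≈⟨ ≈-trans (·-congʳ (≈-trans (↑-congˡ 6 E3·δ) (one↑ 6))) (·-identityˡ _) ⟩
  x · (E 3 ↑ (k ∸ 6) · κ ↑ k)
    ≈⟨ ·-congˡ (pow-quotient (k ∸ 6) k) ⟨
  x · F-odd (suc l) ∎
  where
  open SetoidReasoning setoid
  x = X ↑ suc l
  k = 12 * suc l
  6≤k : 6 ≤ k
  6≤k = ℕ.≤-trans (ℕ.m≤m+n 6 6) (ℕ.m≤m*n 12 (suc l))

i²·t↑ : ∀ l → i ↑ 2 · t ↑ suc l ≈ X ↑ suc l · F-even (suc l)
i²·t↑ l = begin
  i ↑ 2 · t ↑ suc l
    ≈⟨ ·-cong (↑-assocʳ κ 3 2) (t↑-E (suc l)) ⟩
  κ ↑ 6 · (x · (E 3 ↑ k · κ ↑ k))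
    ≈⟨ solve 4 (λ u x e v → u :* (x :* (e :* v)) := x :* (e :* (v :* u))) ≈-refl (κ ↑ 6) x (E 3 ↑ k) (κ ↑ k) ⟩
  x · (E 3 ↑ k · (κ ↑ k · κ ↑ 6))
    ≈⟨ ·-congˡ (·-congˡ (↑-homo-· κ k 6)) ⟨
  x · (E 3 ↑ k · κ ↑ (k + 6))
    ≈⟨ ·-congˡ (pow-quotient k (k + 6)) ⟨
  x · F-even (suc l) ∎
  where
  open SetoidReasoning setoid
  x = X ↑ suc l
  k = 12 * suc l

theorem3p7 : (j : ℕ) → 1 ≤ j →
    ((n : ℕ) → p93 (3 ^ (2 * j ∸ 1) * n + (3 ^ (2 * j ∸ 1) + 5) / 4)
    ≡ shiftedSum (c (2 * j ∸ 1)) F-odd n)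
    × ((n : ℕ) → p93 (3 ^ (2 * j) * n + (3 ^ (2 * j + 1) + 5) / 4)
    ≡ shiftedSum (c (2 * j)) F-even n)
theorem3p7 (suc j) _ = formulas (2 * suc j) (2 * suc j + 1) (ℕ.*-comm 2 (suc j))
  (trans (ℕ.+-comm (2 * suc j) 1) (cong suc (ℕ.*-comm 2 (suc j))))
  where
  -- The exponents are made variables so that matching on `refl` replaces them by the forms 2 + j *
  -- 2 and 3 + j * 2 used in the induction.
  formulas : ∀ k k′ → k ≡ 2 + j * 2 → k′ ≡ 3 + j * 2 →
      ((n : ℕ) → p93 (3 ^ (k ∸ 1) * n + (3 ^ (k ∸ 1) + 5) / 4) ≡ shiftedSum (c (k ∸ 1)) F-odd n)
    × ((n : ℕ) → p93 (3 ^ k * n + (3 ^ k′ + 5) / 4) ≡ shiftedSum (c k) F-even n)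
  formulas _ _ refl refl
    = (λ n → trans (sym (oddT-at j n)) (trans (at (oddT≈ j) (suc n))
          (·-W-shiftedSum (α ↑ 2) (1 + j * 2) F-odd refl α²·t↑ n)))
    , (λ n → trans (sym (evenT-at j n)) (trans (at (evenT≈ j) (suc n))
          (·-W-shiftedSum (i ↑ 2) (2 + j * 2) F-even refl i²·t↑ n)))
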